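{- There exists an absolute constant $C$ such that for all positive integers $r,n$ with $r\leq n/2$, every $n$-vertex graph with average degree at least $Cr\log(n/r)$ contains an $r$-regular subgraph.
   Context: All graphs are finite and simple with non-empty vertex sets. Logarithms are to base $2$. An $r$-regular subgraph is a subgraph (with non-empty vertex set) in which every vertex has degree exactly $r$. -}

module Defs where

open import Data.Nat using (ℕ; zero; suc; _+_; _*_; _^_; _≤_)
open import Data.Bool using (Bool; true; false; if_then_else_)
open import Data.Fin using (Fin)
open import Data.List using (List; map; allFin)
open import Data.Nat.ListAction using (sum)
open import Data.Product using (Σ; _×_; ∃)
open import Relation.Binary.PropositionalEquality using (_≡_; _≢_)

record Graph (n : ℕ) : Set where
  field
    adj   : Fin n → Fin n → Bool
    sym   : ∀ u v → adj u v ≡ adj v u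
    irrefl : ∀ v → adj v v ≡ false
open Graph public

degree : {n : ℕ} → (Fin n → Fin n → Bool) → Fin n → ℕ
degree {n} A v = sum (map (λ u → if A v u then 1 else 0) (allFin n))

degreeSum : {n : ℕ} → Graph n → ℕ
degreeSum {n} G = sum (map (degree (adj G)) (allFin n))

HasRegularSubgraph : {n : ℕ} → ℕ → Graph n → Set
HasRegularSubgraph {n} r G =
  Σ (Fin n → Bool) λ S → Σ (Fin n → Fin n → Bool) λ H →
    (∃ λ v → S v ≡ true)
    × (∀ u v → H u v ≡ H v u)
    × (∀ u v → H u v ≡ true → adj G u v ≡ true)
    × (∀ u v → H u v ≡ true → (S u ≡ true × S v ≡ true))
    × (∀ v → S v ≡ true → degree H v ≡ r)

-- "average degree ≥ C r log₂(n/r)", i.e. degreeSum/n ≥ C r log₂(n/r),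
-- equivalently 2^(degreeSum) ≥ (n/r)^(C r n), cleared of denominators:
AvgDegreeCondition : {n : ℕ} → ℕ → ℕ → Graph n → Set
AvgDegreeCondition {n} C r G = n ^ (C * r * n) ≤ 2 ^ degreeSum G * r ^ (C * r * n)

{-# OPTIONS --safe #-}
module Submission where

-- Pass to disjoint vertex sets A, B with |A| = |B| = m such that every vertex of A has at least
-- d ≈ r log₂(n/r) + O(r) neighbours in B, and give a ∈ A a weight proportional to 2^(-deg_B(a)/r).
-- If G[A, B] has no r-factor, max-flow min-cut yields Y ⊆ B such that X = {a ∈ A : deg_Y(a) < r}
-- satisfies e(X, Y) < r (|X| - |B ∖ Y|). Let X₀ be X without its k = |X| - |B ∖ Y| heaviest
-- vertices. Passing from (A, B) to (X₀, B ∖ Y) does not increase the total weight: X₀ loses fewer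
-- than r k edges, each of which costs at most θ/r, where θ is the largest weight in X₀, while the k
-- discarded vertices weigh at least θ each. Likewise a vertex carrying a 1/r fraction of the weight
-- may be discarded together with any vertex of B. So m can be decreased until an r-factor appears:
-- the total weight never exceeds its initial value, and this keeps m from dropping below r because
-- a vertex with fewer than 2r neighbours in B would be too heavy.

open import Defs renaming (sym to adj-sym)
open import Data.Bool using (Bool; true; false; if_then_else_; _∧_; _∨_; not)
open import Data.Bool.Properties using (∨-comm; ∨-zeroʳ) renaming (_≟_ to _≟ᵇ_)
open import Data.Fin using (Fin; zero; suc)
open import Data.Fin.Properties using (any?) renaming (_≟_ to _≟ᶠ_)
open import Data.Fin.Subset using (Subset)
open import Data.Fin.Subset.Properties using (anySubset?)
open import Data.List using (List; []; _∷_; map; allFin; tabulate)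
open import Data.List.Membership.Propositional using () renaming (_∈_ to _∈ˡ_)
open import Data.List.Membership.Propositional.Properties using (∈-allFin)
open import Data.List.Properties using (map-tabulate)
open import Data.List.Relation.Unary.Any using (here; there)
open import Data.Nat
open import Data.Nat.DivMod
open import Data.Nat.ListAction using (sum)
open import Data.Nat.Properties
open import Data.Nat.Divisibility using (n∣m*n)
open import Data.Nat.Solver using (module +-*-Solver)
open import Data.Product using (Σ; ∃; _×_; _,_; proj₁; proj₂)
open import Data.Sum as Sum using (_⊎_; inj₁; inj₂)
import Data.Vec as Vec
open import Data.Vec.Properties using (lookup∘tabulate)
open import Function using (_∘_)
open import Relation.Binary.PropositionalEquality hiding ([_])
open import Relation.Nullary using (Dec; yes; no; does; ¬_; contradiction)
open import Relation.Nullary.Decidable using (_×-dec_; ¬?)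
open import Algebra.Properties.CommutativeMonoid.Sum +-0-commutativeMonoid using (sum-cong-≗; ∑-distrib-+; ∑-comm) renaming (sum to ∑)
open import Algebra.Properties.Semiring.Sum +-*-semiring using (*-distribˡ-sum)
open import Algebra.Properties.CommutativeSemigroup *-commutativeSemigroup using () renaming (x∙yz≈y∙xz to *-swap)

-- Sums over vertex sets

⟦_⟧ : Bool → ℕ
⟦ b ⟧ = if b then 1 else 0

⟦⟧≤1 : ∀ b → ⟦ b ⟧ ≤ 1
⟦⟧≤1 true  = ≤-refl
⟦⟧≤1 false = z≤n

VertexSet : ℕ → Set
VertexSet n = Fin n → Bool

infix 4 _∈_ _⊆_

_∈_ : ∀ {n} → Fin n → VertexSet n → Set
u ∈ S = S u ≡ true

_⊆_ : ∀ {n} → VertexSet n → VertexSet n → Set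
S ⊆ T = ∀ u → u ∈ S → u ∈ T

-- Opaque, so that the summation set and the summand can be inferred from a sum.
opaque
  ∑∈ : ∀ {n} → VertexSet n → (Fin n → ℕ) → ℕ
  ∑∈ S f = ∑ λ u → ⟦ S u ⟧ * f u

size : ∀ {n} → VertexSet n → ℕ
size S = ∑∈ S λ _ → 1

sum-allFin : ∀ {n} (f : Fin n → ℕ) → sum (map f (allFin n)) ≡ ∑ f
sum-allFin f = trans (cong sum (map-tabulate (λ u → u) f)) (sum-tabulate f)
  where
  sum-tabulate : ∀ {n} (f : Fin n → ℕ) → sum (tabulate f) ≡ ∑ f
  sum-tabulate {zero}  f = refl
  sum-tabulate {suc n} f = cong (f zero +_) (sum-tabulate (f ∘ suc))

∑-mono : ∀ {n} {f g : Fin n → ℕ} → (∀ u → f u ≤ g u) → ∑ f ≤ ∑ g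
∑-mono {zero}  f≤g = z≤n
∑-mono {suc n} f≤g = +-mono-≤ (f≤g zero) (∑-mono (f≤g ∘ suc))

term≤∑ : ∀ {n} (f : Fin n → ℕ) u → f u ≤ ∑ f
term≤∑ f zero    = m≤m+n _ _
term≤∑ f (suc u) = ≤-trans (term≤∑ (f ∘ suc) u) (m≤n+m _ _)

∑-positive : ∀ {n} (f : Fin n → ℕ) → 0 < ∑ f → ∃ λ u → 0 < f u
∑-positive {suc n} f 0<∑ with f zero in eq
... | suc _ = zero , subst (0 <_) (sym eq) z<s
... | zero with u , 0<fu ← ∑-positive (f ∘ suc) 0<∑ = suc u , 0<fu

-- A strict inequality at one point would survive in the total. This turns a double count into
-- equalities at single vertices.
∑-pointwise-≡ : ∀ {n} {f g : Fin n → ℕ} → (∀ u → f u ≤ g u) → ∑ g ≤ ∑ f → ∀ u → f u ≡ g u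
∑-pointwise-≡ {suc n} {f} {g} f≤g ∑g≤∑f zero = ≤-antisym (f≤g zero)
  (+-cancelʳ-≤ _ _ _ (≤-trans ∑g≤∑f (+-monoʳ-≤ (f zero) (∑-mono (f≤g ∘ suc)))))
∑-pointwise-≡ {suc n} {f} {g} f≤g ∑g≤∑f (suc u) = ∑-pointwise-≡ (f≤g ∘ suc)
  (+-cancelˡ-≤ (g zero) _ _ (≤-trans ∑g≤∑f (+-monoˡ-≤ _ (f≤g zero)))) u

opaque
  unfolding ∑∈

  ∑∈-mono : ∀ {n} (S : VertexSet n) {f g} → (∀ u → u ∈ S → f u ≤ g u) → ∑∈ S f ≤ ∑∈ S g
  ∑∈-mono S {f} {g} f≤g = ∑-mono pointwise
    where
    pointwise : ∀ u → ⟦ S u ⟧ * f u ≤ ⟦ S u ⟧ * g u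
    pointwise u with S u in eq
    ... | true  = *-monoʳ-≤ 1 (f≤g u eq)
    ... | false = z≤n

∑∈-cong : ∀ {n} (S : VertexSet n) {f g} → (∀ u → u ∈ S → f u ≡ g u) → ∑∈ S f ≡ ∑∈ S g
∑∈-cong S f≡g = ≤-antisym (∑∈-mono S λ u p → ≤-reflexive (f≡g u p))
                          (∑∈-mono S λ u p → ≤-reflexive (sym (f≡g u p)))

opaque
  unfolding ∑∈

  ∑∈-distrib-+ : ∀ {n} (S : VertexSet n) f g → ∑∈ S (λ u → f u + g u) ≡ ∑∈ S f + ∑∈ S g
  ∑∈-distrib-+ S f g = trans (sum-cong-≗ λ u → *-distribˡ-+ ⟦ S u ⟧ (f u) (g u)) (∑-distrib-+ (λ u → ⟦ S u ⟧ * f u) λ u → ⟦ S u ⟧ * g u)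

  ∑∈-distribˡ-* : ∀ {n} (S : VertexSet n) c f → ∑∈ S (λ u → c * f u) ≡ c * ∑∈ S f
  ∑∈-distribˡ-* S c f = trans (sum-cong-≗ λ u → *-swap ⟦ S u ⟧ c (f u)) (sym (*-distribˡ-sum c λ u → ⟦ S u ⟧ * f u))

∑∈-const : ∀ {n} (S : VertexSet n) c → ∑∈ S (λ _ → c) ≡ c * size S
∑∈-const S c = trans (∑∈-cong S λ _ _ → sym (*-identityʳ c)) (∑∈-distribˡ-* S c λ _ → 1)

opaque
  unfolding ∑∈

  ∑∈-comm : ∀ {n} (P Q : VertexSet n) (f : Fin n → Fin n → ℕ) →
    ∑∈ P (λ u → ∑∈ Q (f u)) ≡ ∑∈ Q (λ v → ∑∈ P λ u → f u v)
  ∑∈-comm P Q f = begin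
    ∑ (λ u → ⟦ P u ⟧ * ∑ λ v → ⟦ Q v ⟧ * f u v)
      ≡⟨ sum-cong-≗ (λ u → *-distribˡ-sum ⟦ P u ⟧ λ v → ⟦ Q v ⟧ * f u v) ⟩
    ∑ (λ u → ∑ λ v → ⟦ P u ⟧ * (⟦ Q v ⟧ * f u v))
      ≡⟨ ∑-comm (λ u v → ⟦ P u ⟧ * (⟦ Q v ⟧ * f u v)) ⟩
    ∑ (λ v → ∑ λ u → ⟦ P u ⟧ * (⟦ Q v ⟧ * f u v))
      ≡⟨ sum-cong-≗ (λ v → sum-cong-≗ λ u → *-swap ⟦ P u ⟧ ⟦ Q v ⟧ (f u v)) ⟩
    ∑ (λ v → ∑ λ u → ⟦ Q v ⟧ * (⟦ P u ⟧ * f u v))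
      ≡⟨ sum-cong-≗ (λ v → sym (*-distribˡ-sum ⟦ Q v ⟧ λ u → ⟦ P u ⟧ * f u v)) ⟩
    ∑ (λ v → ⟦ Q v ⟧ * ∑ λ u → ⟦ P u ⟧ * f u v) ∎
    where
    open ≡-Reasoning

  term≤∑∈ : ∀ {n} (S : VertexSet n) f {u} → u ∈ S → f u ≤ ∑∈ S f
  term≤∑∈ S f {u} u∈S = begin
    f u             ≡⟨ *-identityˡ (f u) ⟨
    1 * f u         ≡⟨ cong (λ b → ⟦ b ⟧ * f u) u∈S ⟨
    ⟦ S u ⟧ * f u   ≤⟨ term≤∑ _ u ⟩
    ∑∈ S f          ∎
    where open ≤-Reasoning

  ∑∈-positive : ∀ {n} (S : VertexSet n) f → 0 < ∑∈ S f → ∃ λ u → u ∈ S × 0 < f u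
  ∑∈-positive S f 0<∑ with u , 0<fu ← ∑-positive _ 0<∑ with S u in eq
  ... | true  = u , eq , subst (0 <_) (*-identityˡ (f u)) 0<fu

size-positive : ∀ {n} (S : VertexSet n) → 0 < size S → ∃ (_∈ S)
size-positive S 0<s with u , u∈S , _ ← ∑∈-positive S _ 0<s = u , u∈S

opaque
  unfolding ∑∈

  ∑∈-⊆ : ∀ {n} {S T : VertexSet n} → S ⊆ T → ∀ f → ∑∈ S f ≤ ∑∈ T f
  ∑∈-⊆ {S = S} {T} S⊆T f = ∑-mono pointwise
    where
    pointwise : ∀ u → ⟦ S u ⟧ * f u ≤ ⟦ T u ⟧ * f u
    pointwise u with S u in eq
    ... | false = z≤n
    ... | true  = ≤-reflexive (cong (λ b → ⟦ b ⟧ * f u) (sym (S⊆T u eq)))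

-- One equation of indicators says that `P` and `Q` are disjoint with union `S`, and makes sums over
-- `S` additive by distributivity.
record Split {n} (S P Q : VertexSet n) : Set where
  constructor split-by
  field indicator : ∀ u → ⟦ S u ⟧ ≡ ⟦ P u ⟧ + ⟦ Q u ⟧
open Split

opaque
  unfolding ∑∈

  ∑∈-split : ∀ {n} {S P Q : VertexSet n} → Split S P Q → ∀ f → ∑∈ S f ≡ ∑∈ P f + ∑∈ Q f
  ∑∈-split {S = S} {P} {Q} split f = trans
    (sum-cong-≗ λ u → trans (cong (_* f u) (indicator split u)) (*-distribʳ-+ (f u) ⟦ P u ⟧ ⟦ Q u ⟧))
    (∑-distrib-+ (λ u → ⟦ P u ⟧ * f u) λ u → ⟦ Q u ⟧ * f u)

infixl 6 _∩_ _∖_ _─_ _∪_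

_∩_ _∖_ _∪_ : ∀ {n} → VertexSet n → VertexSet n → VertexSet n
(S ∩ T) u = S u ∧ T u
(S ∪ T) u = S u ∨ T u
(S ∖ T) u = S u ∧ not (T u)

point : ∀ {n} → Fin n → VertexSet n
point v u = does (u ≟ᶠ v)

_─_ : ∀ {n} → VertexSet n → Fin n → VertexSet n
S ─ v = S ∖ point v

⟦⟧-split : ∀ b c → ⟦ b ⟧ ≡ ⟦ b ∧ not c ⟧ + ⟦ b ∧ c ⟧
⟦⟧-split false _     = refl
⟦⟧-split true  false = refl
⟦⟧-split true  true  = refl

∖-∩-split : ∀ {n} (S T : VertexSet n) → Split S (S ∖ T) (S ∩ T)
∖-∩-split S T = split-by λ u → ⟦⟧-split (S u) (T u)

∖-split : ∀ {n} {S T : VertexSet n} → T ⊆ S → Split S (S ∖ T) T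
∖-split {S = S} {T} T⊆S = split-by pointwise
  where
  pointwise : ∀ u → ⟦ S u ⟧ ≡ ⟦ (S ∖ T) u ⟧ + ⟦ T u ⟧
  pointwise u with T u in eq
  ... | true  rewrite T⊆S u eq = refl
  ... | false with S u
  ...   | true  = refl
  ...   | false = refl

point⊆ : ∀ {n} {S : VertexSet n} {v} → v ∈ S → point v ⊆ S
point⊆ {v = v} v∈S u p with u ≟ᶠ v
... | yes refl = v∈S

─-split : ∀ {n} {S : VertexSet n} {v} → v ∈ S → Split S (S ─ v) (point v)
─-split {S = S} v∈S = ∖-split (point⊆ {S = S} v∈S)

∧-true : ∀ {b c} → b ∧ c ≡ true → b ≡ true × c ≡ true
∧-true {true} {true} _ = refl , refl

∖⊆ : ∀ {n} (S T : VertexSet n) → S ∖ T ⊆ S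
∖⊆ S T u p = proj₁ (∧-true p)

∈point : ∀ {n} (v : Fin n) → v ∈ point v
∈point v with v ≟ᶠ v
... | yes _   = refl
... | no  v≢v = contradiction refl v≢v

opaque
  unfolding ∑∈

  ∑∈-point : ∀ {n} (v : Fin n) f → ∑∈ (point v) f ≡ f v
  ∑∈-point {n} v f = ≤-antisym (upper v f) (term≤∑∈ (point v) f (∈point v))
    where
    upper : ∀ {n} (v : Fin n) f → ∑∈ (point v) f ≤ f v
    upper {suc n} zero f = ≤-reflexive (trans (cong (f zero + 0 +_) (∑-zero n)) (trans (+-identityʳ _) (+-identityʳ _)))
      where
      ∑-zero : ∀ n → ∑ {n} (λ _ → 0) ≡ 0
      ∑-zero zero    = refl
      ∑-zero (suc n) = ∑-zero n
    upper {suc n} (suc v) f = ≤-trans (≤-reflexive (sum-cong-≗ λ u → cong (λ b → ⟦ b ⟧ * f (suc u)) (does-suc u))) (upper v (f ∘ suc))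
      where
      does-suc : ∀ u → point (suc v) (suc u) ≡ point v u
      does-suc u with u ≟ᶠ v
      ... | yes _ = refl
      ... | no  _ = refl

∑∈-remove : ∀ {n} {S : VertexSet n} {v} → v ∈ S → ∀ f → ∑∈ S f ≡ ∑∈ (S ─ v) f + f v
∑∈-remove {S = S} {v} v∈S f = trans (∑∈-split (─-split v∈S) f) (cong (∑∈ (S ─ v) f +_) (∑∈-point v f))

size-remove : ∀ {n} {S : VertexSet n} {v} → v ∈ S → size S ≡ suc (size (S ─ v))
size-remove {S = S} v∈S = trans (∑∈-remove {S = S} v∈S λ _ → 1) (+-comm (size (S ─ _)) 1)

opaque
  unfolding ∑∈

  size≤n : ∀ {n} (S : VertexSet n) → size S ≤ n
  size≤n {zero}  S = z≤n
  size≤n {suc n} S = +-mono-≤ (≤-trans (≤-reflexive (*-identityʳ _)) (⟦⟧≤1 (S zero))) (size≤n (S ∘ suc))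

argmax : ∀ {n} (S : VertexSet n) (w : Fin n → ℕ) → ∃ (_∈ S) → ∃ λ x → x ∈ S × (∀ u → u ∈ S → w u ≤ w x)
argmax S w (x₀ , x₀∈S) = go (∑ w) x₀ x₀∈S (m≤n+m _ _)
  where
  -- `k` bounds the gap between `w x` and the total, which dominates all values of `w`; every
  -- improvement uses up a unit of it.
  go : ∀ k x → x ∈ S → ∑ w ≤ w x + k → ∃ λ x → x ∈ S × (∀ u → u ∈ S → w u ≤ w x)
  go k x x∈S bound with any? above?
    where
    above? : ∀ u → Dec (u ∈ S × w x < w u)
    above? u = (S u ≟ᵇ true) ×-dec (w x <? w u)
  go k       x x∈S bound | no  none = x , x∈S , λ u u∈S → ≮⇒≥ λ lt → none (u , u∈S , lt)
  go zero    x x∈S bound | yes (u , u∈S , lt) =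
    contradiction (≤-trans (term≤∑ w u) (≤-trans bound (≤-reflexive (+-identityʳ _)))) (<⇒≱ lt)
  go (suc k) x x∈S bound | yes (u , u∈S , lt) = go k u u∈S
    (≤-trans bound (≤-trans (≤-reflexive (+-suc (w x) k)) (+-monoˡ-≤ k lt)))

-- Maxima are discarded one at a time, so `θ`, the weight of the last one, bounds the remaining
-- weights from above and each of the `k` discarded weights from below.
dropLargest : ∀ {n} (S : VertexSet n) (w : Fin n → ℕ) k → k ≤ size S →
  ∃ λ S' → ∃ λ θ → S' ⊆ S × size S' + k ≡ size S × ∑∈ S' w + θ * k ≤ ∑∈ S w × (∀ u → u ∈ S' → w u ≤ θ)
-- Nothing is discarded, so any upper bound on the weights can be `θ`; their total is one.
dropLargest S w zero _ = S , ∑∈ S w , (λ _ p → p) , +-identityʳ _ ,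
  ≤-reflexive (trans (cong (∑∈ S w +_) (*-zeroʳ (∑∈ S w))) (+-identityʳ _)) , λ u → term≤∑∈ S w
dropLargest S w (suc k) k<s
  with S' , θ , S'⊆S , size≡ , sum≤ , w≤θ ← dropLargest S w k (<⇒≤ k<s)
  with x , x∈S' , w≤wx ← argmax S' w (size-positive S' (+-cancelʳ-< k 0 (size S') (≤-trans k<s (≤-reflexive (sym size≡)))))
  = S' ─ x , w x , (λ u p → S'⊆S u (∖⊆ S' (point x) u p))
  , trans (+-suc _ k) (trans (cong (_+ k) (sym (size-remove {S = S'} x∈S'))) size≡)
  , (begin
      ∑∈ (S' ─ x) w + w x * suc k       ≡⟨ cong (∑∈ (S' ─ x) w +_) (*-suc (w x) k) ⟩
      ∑∈ (S' ─ x) w + (w x + w x * k)   ≡⟨ +-assoc (∑∈ (S' ─ x) w) (w x) _ ⟨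
      ∑∈ (S' ─ x) w + w x + w x * k     ≡⟨ cong (_+ w x * k) (∑∈-remove {S = S'} x∈S' w) ⟨
      ∑∈ S' w + w x * k                 ≤⟨ +-monoʳ-≤ (∑∈ S' w) (*-monoˡ-≤ k (w≤θ x x∈S')) ⟩
      ∑∈ S' w + θ * k                   ≤⟨ sum≤ ⟩
      ∑∈ S w                            ∎)
  , λ u p → w≤wx u (∖⊆ S' (point x) u p)
  where open ≤-Reasoning

opaque
  unfolding ∑∈

  ∑∈-pointwise-≡ : ∀ {n} (S : VertexSet n) {f g : Fin n → ℕ} → (∀ u → u ∈ S → f u ≤ g u) →
    ∑∈ S g ≤ ∑∈ S f → ∀ u → u ∈ S → f u ≡ g u
  ∑∈-pointwise-≡ S {f} {g} f≤g ∑g≤∑f u u∈S = begin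
    f u             ≡⟨ *-identityˡ (f u) ⟨
    1 * f u         ≡⟨ cong (λ b → ⟦ b ⟧ * f u) u∈S ⟨
    ⟦ S u ⟧ * f u   ≡⟨ ∑-pointwise-≡ pointwise ∑g≤∑f u ⟩
    ⟦ S u ⟧ * g u   ≡⟨ cong (λ b → ⟦ b ⟧ * g u) u∈S ⟩
    1 * g u         ≡⟨ *-identityˡ (g u) ⟩
    g u             ∎
    where
    open ≡-Reasoning
    pointwise : ∀ u → ⟦ S u ⟧ * f u ≤ ⟦ S u ⟧ * g u
    pointwise u with S u in eq
    ... | true  = *-monoʳ-≤ 1 (f≤g u eq)
    ... | false = z≤n

  ∑∈-indicator-comm : ∀ {n} (S T : VertexSet n) → ∑∈ S (λ u → ⟦ T u ⟧) ≡ ∑∈ T (λ u → ⟦ S u ⟧)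
  ∑∈-indicator-comm S T = sum-cong-≗ λ u → *-comm ⟦ S u ⟧ ⟦ T u ⟧

∑∈-indicator-point : ∀ {n} (S : VertexSet n) v → ∑∈ S (λ u → ⟦ point v u ⟧) ≡ ⟦ S v ⟧
∑∈-indicator-point S v = trans (∑∈-indicator-comm S (point v)) (∑∈-point v λ u → ⟦ S u ⟧)

∪-split : ∀ {n} (S T : VertexSet n) → Split (S ∪ T) S (T ∖ S)
∪-split S T = split-by λ u → pointwise (S u) (T u)
  where
  pointwise : ∀ b c → ⟦ b ∨ c ⟧ ≡ ⟦ b ⟧ + ⟦ c ∧ not b ⟧
  pointwise true  true  = refl
  pointwise true  false = refl
  pointwise false true  = refl
  pointwise false false = refl

∑∈-∪-∩ : ∀ {n} (S T : VertexSet n) f → ∑∈ (S ∪ T) f + ∑∈ (T ∩ S) f ≡ ∑∈ S f + ∑∈ T f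
∑∈-∪-∩ S T f = begin
  ∑∈ (S ∪ T) f + ∑∈ (T ∩ S) f               ≡⟨ cong (_+ ∑∈ (T ∩ S) f) (∑∈-split (∪-split S T) f) ⟩
  ∑∈ S f + ∑∈ (T ∖ S) f + ∑∈ (T ∩ S) f      ≡⟨ +-assoc (∑∈ S f) _ _ ⟩
  ∑∈ S f + (∑∈ (T ∖ S) f + ∑∈ (T ∩ S) f)    ≡⟨ cong (∑∈ S f +_) (∑∈-split (∖-∩-split T S) f) ⟨
  ∑∈ S f + ∑∈ T f                           ∎
  where open ≡-Reasoning

∉point : ∀ {n} {u v : Fin n} → u ≢ v → point v u ≡ false
∉point {u = u} {v} u≢v with u ≟ᶠ v
... | yes u≡v = contradiction u≡v u≢v
... | no  _   = refl

full : ∀ {n} → VertexSet n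
full _ = true

∩⊆ʳ : ∀ {n} (S T : VertexSet n) → S ∩ T ⊆ T
∩⊆ʳ S T u p = proj₂ (∧-true p)

∩⊆ˡ : ∀ {n} (S T : VertexSet n) → S ∩ T ⊆ S
∩⊆ˡ S T u p = proj₁ (∧-true p)

-- Bipartite flows: max-flow min-cut by deleting edges

-- Truncation at `r` is concave, so it keeps degrees submodular: `p`, `q`, `u`, `i` stand for the
-- degrees into two sets, their union and their intersection. If `p` and `q` are at most `r`, the
-- truncations on the right disappear; otherwise one of them equals `r` and absorbs `r ⊓ u`.
⊓-submodular : ∀ r {p q u i} → i ≤ p → i ≤ q → u + i ≡ p + q → r ⊓ u + r ⊓ i ≤ r ⊓ p + r ⊓ q
⊓-submodular r {p} {q} {u} {i} i≤p i≤q u+i≡p+q with ≤-total p r | ≤-total q r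
... | inj₁ p≤r | inj₁ q≤r = begin
  r ⊓ u + r ⊓ i ≤⟨ +-mono-≤ (m⊓n≤n r u) (m⊓n≤n r i) ⟩
  u + i         ≡⟨ u+i≡p+q ⟩
  p + q         ≡⟨ cong₂ _+_ (m≥n⇒m⊓n≡n p≤r) (m≥n⇒m⊓n≡n q≤r) ⟨
  r ⊓ p + r ⊓ q ∎
  where open ≤-Reasoning
... | inj₂ r≤p | _ = +-mono-≤ (≤-trans (m⊓n≤m r u) (≤-reflexive (sym (m≤n⇒m⊓n≡m r≤p)))) (⊓-monoʳ-≤ r i≤q)
... | inj₁ _ | inj₂ r≤q = ≤-trans
  (+-mono-≤ (≤-trans (m⊓n≤m r u) (≤-reflexive (sym (m≤n⇒m⊓n≡m r≤q)))) (⊓-monoʳ-≤ r i≤p))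
  (≤-reflexive (+-comm (r ⊓ q) (r ⊓ p)))

Relation : ℕ → Set
Relation n = Fin n → Fin n → Bool

deg : ∀ {n} → Relation n → VertexSet n → Fin n → ℕ
deg E Y a = ∑∈ Y λ b → ⟦ E a b ⟧

infixl 6 _⊖_

_⊖_ : ∀ {n} → Relation n → Fin n × Fin n → Relation n
(E ⊖ (a , b)) u v = E u v ∧ not (point a u ∧ point b v)

module _ {n : ℕ} where

  deg-⊖ : ∀ (E : Relation n) {a b} → E a b ≡ true → ∀ Y u →
    deg E Y u ≡ deg (E ⊖ (a , b)) Y u + ⟦ point a u ⟧ * ⟦ Y b ⟧
  deg-⊖ E {a} {b} Eab Y u = begin
    ∑∈ Y (λ v → ⟦ E u v ⟧)
      ≡⟨ ∑∈-cong Y (λ v _ → pointwise v) ⟩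
    ∑∈ Y (λ v → ⟦ (E ⊖ (a , b)) u v ⟧ + ⟦ point a u ⟧ * ⟦ point b v ⟧)
      ≡⟨ ∑∈-distrib-+ Y (λ v → ⟦ (E ⊖ (a , b)) u v ⟧) (λ v → ⟦ point a u ⟧ * ⟦ point b v ⟧) ⟩
    deg (E ⊖ (a , b)) Y u + ∑∈ Y (λ v → ⟦ point a u ⟧ * ⟦ point b v ⟧)
      ≡⟨ cong (deg (E ⊖ (a , b)) Y u +_) (∑∈-distribˡ-* Y ⟦ point a u ⟧ λ v → ⟦ point b v ⟧) ⟩
    deg (E ⊖ (a , b)) Y u + ⟦ point a u ⟧ * ∑∈ Y (λ v → ⟦ point b v ⟧)
      ≡⟨ cong (λ k → deg (E ⊖ (a , b)) Y u + ⟦ point a u ⟧ * k) (∑∈-indicator-point Y b) ⟩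
    deg (E ⊖ (a , b)) Y u + ⟦ point a u ⟧ * ⟦ Y b ⟧ ∎
    where
    open ≡-Reasoning
    pointwise : ∀ v → ⟦ E u v ⟧ ≡ ⟦ (E ⊖ (a , b)) u v ⟧ + ⟦ point a u ⟧ * ⟦ point b v ⟧
    pointwise v with u ≟ᶠ a | v ≟ᶠ b | E u v in eq
    ... | no _     | _        | true  = refl
    ... | no _     | _        | false = refl
    ... | yes _    | no _     | true  = refl
    ... | yes _    | no _     | false = refl
    ... | yes _    | yes _    | true  = refl
    ... | yes refl | yes refl | false with () ← trans (sym Eab) eq

  edges : Relation n → ℕ
  edges E = ∑∈ full (deg E full)

  -- The edge count will bound the number of deletions. If it did not drop, all degrees would be
  -- unchanged, contrary to the loss at `a`.
  edges-⊖ : ∀ (E : Relation n) {a b} → E a b ≡ true → edges (E ⊖ (a , b)) < edges E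
  edges-⊖ E {a} {b} Eab = ≰⇒> λ le → m+1+n≢m (deg E' full a) (sym (begin
    deg E' full a                                   ≡⟨ ∑∈-pointwise-≡ full (λ u _ → deg≤ u) le a refl ⟩
    deg E full a                                    ≡⟨ deg-⊖ E Eab full a ⟩
    deg E' full a + ⟦ point a a ⟧ * 1               ≡⟨ cong (λ c → deg E' full a + ⟦ c ⟧ * 1) (∈point a) ⟩
    deg E' full a + 1                               ∎))
    where
    open ≡-Reasoning
    E' = E ⊖ (a , b)
    deg≤ : ∀ u → deg E' full u ≤ deg E full u
    deg≤ u = ≤-trans (m≤m+n _ _) (≤-reflexive (sym (deg-⊖ E Eab full u)))

  module _ (A : VertexSet n) (r : ℕ) (w : Fin n → ℕ) where

    -- The capacity of the cut separating the demands w on Y from sources of capacity r on A.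
    cover : Relation n → VertexSet n → ℕ
    cover E Y = ∑∈ A λ a → r ⊓ deg E Y a

    indeg : Relation n → Fin n → ℕ
    indeg E b = ∑∈ A λ a → ⟦ E a b ⟧

    Violates : Relation n → VertexSet n → Set
    Violates E Y = cover E Y < ∑∈ Y w

    Good : Relation n → Set
    Good E = ∀ Y → ∑∈ Y w ≤ cover E Y

    Tight : Relation n → VertexSet n → Set
    Tight E Y = cover E Y ≤ ∑∈ Y w

    -- The search runs over vectors, where `anySubset?` decides existence; `no-violator⇒good`
    -- extends the outcome to every vertex set by comparing it with its tabulation.
    violator? : ∀ E → Dec (∃ λ (Y : Subset n) → Violates E (Vec.lookup Y))
    violator? E = anySubset? λ Y → cover E (Vec.lookup Y) <? ∑∈ (Vec.lookup Y) w

    ∑∈-cong-set : ∀ {S T : VertexSet n} → (∀ u → S u ≡ T u) → ∀ f → ∑∈ S f ≤ ∑∈ T f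
    ∑∈-cong-set S≗T f = ∑∈-⊆ (λ u u∈S → trans (sym (S≗T u)) u∈S) f

    no-violator⇒good : ∀ E → ¬ (∃ λ (Y : Subset n) → Violates E (Vec.lookup Y)) → Good E
    no-violator⇒good E none Y = begin
      ∑∈ Y w             ≤⟨ ∑∈-cong-set (sym ∘ lookup∘tabulate Y) w ⟩
      ∑∈ Y' w            ≤⟨ ≮⇒≥ (λ lt → none (Vec.tabulate Y , lt)) ⟩
      cover E Y'         ≤⟨ ∑∈-mono A (λ a _ → ⊓-monoʳ-≤ r (∑∈-cong-set (lookup∘tabulate Y) _)) ⟩
      cover E Y          ∎
      where
      open ≤-Reasoning
      Y' = Vec.lookup (Vec.tabulate Y)

    -- Uncrossing: truncated degrees are submodular and demands are modular, so two tight sets leave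
    -- no slack at the intersection once goodness is applied to the union.
    tight-∩ : ∀ E → Good E → ∀ S T → Tight E S → Tight E T → Tight E (T ∩ S)
    tight-∩ E goodE S T tS tT = +-cancelˡ-≤ (cover E (S ∪ T)) _ _ (begin
      cover E (S ∪ T) + cover E (T ∩ S)
        ≡⟨ ∑∈-distrib-+ A _ _ ⟨
      ∑∈ A (λ a → r ⊓ deg E (S ∪ T) a + r ⊓ deg E (T ∩ S) a)
        ≤⟨ ∑∈-mono A (λ a _ → ⊓-submodular r (∑∈-⊆ (∩⊆ʳ T S) _) (∑∈-⊆ (∩⊆ˡ T S) _) (∑∈-∪-∩ S T _)) ⟩
      ∑∈ A (λ a → r ⊓ deg E S a + r ⊓ deg E T a)
        ≡⟨ ∑∈-distrib-+ A _ _ ⟩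
      cover E S + cover E T
        ≤⟨ +-mono-≤ tS tT ⟩
      ∑∈ S w + ∑∈ T w
        ≡⟨ ∑∈-∪-∩ S T w ⟨
      ∑∈ (S ∪ T) w + ∑∈ (T ∩ S) w
        ≤⟨ +-monoˡ-≤ _ (goodE (S ∪ T)) ⟩
      cover E (S ∪ T) + ∑∈ (T ∩ S) w ∎)
      where open ≤-Reasoning

    -- Losing one edge lowers `cover` by at most 1, so only a tight set can become violated. It
    -- lowers `cover` not at all when `b` is outside `Y` or when `a` keeps at least `r` neighbours
    -- in `Y`; both would contradict goodness.
    critical-tight : ∀ E → Good E → ∀ {a b} → E a b ≡ true → ∀ {Y} → Violates (E ⊖ (a , b)) Y →
      Tight E Y × b ∈ Y × deg E Y a ≤ r
    critical-tight E goodE {a} {b} Eab {Y} viol = tight , b∈Y , deg≤r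
      where
      E' = E ⊖ (a , b)
      open ≤-Reasoning

      tight : Tight E Y
      tight = begin
        cover E Y
          ≤⟨ ∑∈-mono A (λ u _ → increment u) ⟩
        ∑∈ A (λ u → r ⊓ deg E' Y u + ⟦ point a u ⟧)
          ≡⟨ ∑∈-distrib-+ A _ _ ⟩
        cover E' Y + ∑∈ A (λ u → ⟦ point a u ⟧)
          ≤⟨ +-monoʳ-≤ _ (≤-trans (≤-reflexive (∑∈-indicator-point A a)) (⟦⟧≤1 (A a))) ⟩
        cover E' Y + 1
          ≡⟨ +-comm _ 1 ⟩
        suc (cover E' Y)
          ≤⟨ viol ⟩
        ∑∈ Y w ∎
        where
        ⊓-+ : ∀ x y → r ⊓ (x + y) ≤ r ⊓ x + y
        ⊓-+ x y = ≤-trans (⊓-monoˡ-≤ (x + y) (m≤m+n r y)) (≤-reflexive (sym (+-distribʳ-⊓ y r x)))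
        increment : ∀ u → r ⊓ deg E Y u ≤ r ⊓ deg E' Y u + ⟦ point a u ⟧
        increment u = begin
          r ⊓ deg E Y u                                  ≡⟨ cong (r ⊓_) (deg-⊖ E Eab Y u) ⟩
          r ⊓ (deg E' Y u + ⟦ point a u ⟧ * ⟦ Y b ⟧)      ≤⟨ ⊓-+ _ _ ⟩
          r ⊓ deg E' Y u + ⟦ point a u ⟧ * ⟦ Y b ⟧        ≤⟨ +-monoʳ-≤ _ (*-monoʳ-≤ ⟦ point a u ⟧ (⟦⟧≤1 (Y b))) ⟩
          r ⊓ deg E' Y u + ⟦ point a u ⟧ * 1              ≡⟨ cong (r ⊓ deg E' Y u +_) (*-identityʳ _) ⟩
          r ⊓ deg E' Y u + ⟦ point a u ⟧                  ∎

      unaffected : (∀ u → r ⊓ deg E Y u ≤ r ⊓ deg E' Y u) → ∀ {X : Set} → X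
      unaffected le = contradiction viol (≤⇒≯ (≤-trans (goodE Y) (∑∈-mono A λ u _ → le u)))

      b∈Y : b ∈ Y
      b∈Y with Y b in eq
      ... | true  = refl
      ... | false = unaffected λ u → ⊓-monoʳ-≤ r (≤-reflexive
        (trans (deg-⊖ E Eab Y u) (trans (cong (λ c → deg E' Y u + ⟦ point a u ⟧ * ⟦ c ⟧) eq)
          (trans (cong (deg E' Y u +_) (*-zeroʳ ⟦ point a u ⟧)) (+-identityʳ _)))))

      deg≤r : deg E Y a ≤ r
      deg≤r = ≮⇒≥ λ r<deg → unaffected (le r<deg)
        where
        le : r < deg E Y a → ∀ u → r ⊓ deg E Y u ≤ r ⊓ deg E' Y u
        le r<deg u = by-cases (u ≟ᶠ a)
          where
          by-cases : Dec (u ≡ a) → r ⊓ deg E Y u ≤ r ⊓ deg E' Y u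
          by-cases (no u≢a) = ⊓-monoʳ-≤ r (≤-reflexive (trans (deg-⊖ E Eab Y u)
            (trans (cong (λ c → deg E' Y u + ⟦ c ⟧ * ⟦ Y b ⟧) (∉point u≢a)) (+-identityʳ _))))
          by-cases (yes refl) = ≤-trans (m⊓n≤m r _) (≤-reflexive (sym (m≤n⇒m⊓n≡m r≤)))
            where
            r≤ : r ≤ deg E' Y a
            r≤ = s≤s⁻¹ (begin
              suc r                                    ≤⟨ r<deg ⟩
              deg E Y a                                ≡⟨ deg-⊖ E Eab Y a ⟩
              deg E' Y a + ⟦ point a a ⟧ * ⟦ Y b ⟧      ≤⟨ +-monoʳ-≤ _ (*-mono-≤ (⟦⟧≤1 (point a a)) (⟦⟧≤1 (Y b))) ⟩
              deg E' Y a + 1                           ≡⟨ +-comm _ 1 ⟩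
              suc (deg E' Y a)                         ∎)

    -- An integral flow, given by its saturated unit edges; only edges leaving `A` count as flow.
    Flow : Relation n → Set
    Flow H = (∀ b → indeg H b ≡ w b) × (∀ a → a ∈ A → deg H full a ≤ r)

    -- If no edge can be removed from E, then each edge at b lies in a tight set containing b; their
    -- intersection T is tight, and comparing T with T ─ b bounds the degree of b by its demand w b.
    critical-flow : ∀ E → Good E → (∀ a b → E a b ≡ true → ∃ (Violates (E ⊖ (a , b)))) → Flow E
    critical-flow E goodE critical = indeg≡ , λ a a∈A →
      m⊓n≡n⇒n≤m (∑∈-pointwise-≡ A (λ u _ → m⊓n≤n r (deg E full u)) saturated a a∈A)
      where
      open ≤-Reasoning

      commonTight : ∀ {a₀} b → E a₀ b ≡ true → (l : List (Fin n)) →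
        ∃ λ T → Tight E T × b ∈ T × (∀ a → a ∈ˡ l → E a b ≡ true → deg E T a ≤ r)
      -- The known edge at `b` supplies a first tight set, so that the family to be intersected is
      -- never empty.
      commonTight {a₀} b Ea₀b [] with Y , viol ← critical a₀ b Ea₀b
        with tight , b∈Y , _ ← critical-tight E goodE Ea₀b viol = Y , tight , b∈Y , λ _ ()
      commonTight b Ea₀b (a ∷ l) with T , tT , b∈T , small ← commonTight b Ea₀b l
        with E a b in Eab
      ... | false = T , tT , b∈T , λ where
        _ (here refl) Eab' → contradiction (trans (sym Eab) Eab') λ ()
        u (there u∈l) Eub → small u u∈l Eub
      ... | true with Y , viol ← critical a b Eab
        with tY , b∈Y , degY≤r ← critical-tight E goodE Eab viol =
        Y ∩ T , tight-∩ E goodE T Y tT tY , cong₂ _∧_ b∈Y b∈T , λ where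
          _ (here refl) _   → ≤-trans (∑∈-⊆ (∩⊆ˡ Y T) _) degY≤r
          u (there u∈l) Eub → ≤-trans (∑∈-⊆ (∩⊆ʳ Y T) _) (small u u∈l Eub)

      indeg≤ : ∀ b → indeg E b ≤ w b
      indeg≤ b with any? (λ a → E a b ≟ᵇ true)
      ... | no none = ≤-trans (∑∈-mono A {g = λ _ → 0} λ a _ → noEdge a)
                        (≤-trans (≤-reflexive (∑∈-const A 0)) z≤n)
        where
        noEdge : ∀ a → ⟦ E a b ⟧ ≤ 0
        noEdge a with E a b in eq
        ... | true  = contradiction (a , eq) none
        ... | false = ≤-refl
      ... | yes (_ , Ea₀b) with T , tT , b∈T , small ← commonTight b Ea₀b (allFin n) =
        +-cancelˡ-≤ (cover E (T ─ b)) _ _ (begin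
          cover E (T ─ b) + indeg E b       ≡⟨ ∑∈-distrib-+ A _ _ ⟨
          ∑∈ A (λ a → r ⊓ deg E (T ─ b) a + ⟦ E a b ⟧)
                                            ≤⟨ ∑∈-mono A (λ a _ → increment a) ⟩
          cover E T                         ≤⟨ tT ⟩
          ∑∈ T w                            ≡⟨ ∑∈-remove {S = T} b∈T w ⟩
          ∑∈ (T ─ b) w + w b                ≤⟨ +-monoˡ-≤ (w b) (goodE (T ─ b)) ⟩
          cover E (T ─ b) + w b             ∎)
        where
        increment : ∀ a → r ⊓ deg E (T ─ b) a + ⟦ E a b ⟧ ≤ r ⊓ deg E T a
        increment a with E a b in Eab
        ... | false = ≤-trans (≤-reflexive (+-identityʳ _)) (⊓-monoʳ-≤ r (∑∈-⊆ (∖⊆ T (point b)) _))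
        -- For a neighbour `a` of `b`, `deg E T a ≤ r` means that the degree into `T` is not
        -- truncated, so removing `b` costs a full unit.
        ... | true  = begin
          r ⊓ deg E (T ─ b) a + 1           ≤⟨ +-monoˡ-≤ 1 (m⊓n≤n r _) ⟩
          deg E (T ─ b) a + 1               ≡⟨ cong (λ c → deg E (T ─ b) a + ⟦ c ⟧) Eab ⟨
          deg E (T ─ b) a + ⟦ E a b ⟧       ≡⟨ ∑∈-remove {S = T} b∈T (λ v → ⟦ E a v ⟧) ⟨
          deg E T a                         ≡⟨ m≥n⇒m⊓n≡n (small a (∈-allFin a) Eab) ⟨
          r ⊓ deg E T a                     ∎

      indeg≡ : ∀ b → indeg E b ≡ w b
      indeg≡ b = ≤-antisym (indeg≤ b) (begin
        w b                                  ≡⟨ ∑∈-point b w ⟨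
        ∑∈ (point b) w                       ≤⟨ goodE (point b) ⟩
        cover E (point b)                    ≤⟨ ∑∈-mono A (λ a _ → m⊓n≤n r _) ⟩
        ∑∈ A (λ a → deg E (point b) a)       ≡⟨ ∑∈-cong A (λ a _ → ∑∈-point b _) ⟩
        indeg E b                            ∎)

      -- All demands are met exactly, so the untruncated degrees sum to no more than the truncated
      -- ones, and no source exceeds its capacity.
      saturated : ∑∈ A (deg E full) ≤ ∑∈ A (λ a → r ⊓ deg E full a)
      saturated = begin
        ∑∈ A (deg E full)                    ≡⟨ ∑∈-comm A full (λ a b → ⟦ E a b ⟧) ⟩
        ∑∈ full (indeg E)                    ≡⟨ ∑∈-cong full (λ b _ → indeg≡ b) ⟩
        ∑∈ full w                            ≤⟨ goodE full ⟩
        cover E full                         ∎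

    -- Deletion replaces augmenting paths: edges are removed while the cut condition survives, and a
    -- relation from which none can be removed is already a flow.
    flow-or-violator : ∀ E → (∃ λ H → (∀ a b → H a b ≡ true → E a b ≡ true) × Flow H) ⊎ ∃ (Violates E)
    flow-or-violator E with violator? E
    ... | yes (Y , viol) = inj₂ (Vec.lookup Y , viol)
    ... | no none = inj₁ (prune (edges E) E ≤-refl (no-violator⇒good E none))
      where
      prune : ∀ k E → edges E ≤ k → Good E → ∃ λ H → (∀ a b → H a b ≡ true → E a b ≡ true) × Flow H
      prune k E bound goodE
        with any? (λ a → any? λ b → (E a b ≟ᵇ true) ×-dec ¬? (violator? (E ⊖ (a , b))))
      ... | no none = E , (λ _ _ p → p) , critical-flow E goodE critical
        where
        critical : ∀ a b → E a b ≡ true → ∃ (Violates (E ⊖ (a , b)))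
        critical a b Eab with violator? (E ⊖ (a , b))
        ... | yes (Y , viol) = Vec.lookup Y , viol
        ... | no  ¬viol      = contradiction (a , b , Eab , ¬viol) none
      prune zero    E bound goodE | yes (a , b , Eab , ¬viol) = contradiction (≤-trans (edges-⊖ E Eab) bound) λ ()
      prune (suc k) E bound goodE | yes (a , b , Eab , ¬viol)
        with H , H⊆E' , flow ← prune k (E ⊖ (a , b)) (s≤s⁻¹ (≤-trans (edges-⊖ E Eab) bound)) (no-violator⇒good _ ¬viol) =
        H , (λ u v p → proj₁ (∧-true (H⊆E' u v p))) , flow

-- The potential of a balanced bipartite pair

module _ (r : ℕ) .{{_ : NonZero r}} where

  -- The piecewise linear interpolation of x ↦ r · 2^(x/r) at the multiples of r: an integer-valued
  -- weight that is multiplied by at most 1 + j/r when its argument grows by j ≤ r.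
  φ : ℕ → ℕ
  φ x = 2 ^ (x / r) * (r + x % r)

  φ-linear : ∀ q {s} → s < r → φ (s + q * r) ≡ 2 ^ q * (r + s)
  φ-linear q {s} s<r = cong₂ (λ a b → 2 ^ a * (r + b)) quotient remainder
    where
    remainder : (s + q * r) % r ≡ s
    remainder = trans ([m+kn]%n≡m%n s q r) (m<n⇒m%n≡m s<r)
    quotient : (s + q * r) / r ≡ q
    quotient = trans (+-distrib-/-∣ʳ s (n∣m*n q)) (cong₂ _+_ (m<n⇒m/n≡0 s<r) (m*n/n≡m q r))

  φ-multiple : ∀ q → φ (q * r) ≡ 2 ^ q * r
  φ-multiple q = trans (φ-linear q (>-nonZero⁻¹ r)) (cong (2 ^ q *_) (+-identityʳ r))

  -- For `j` at most `r`, adding `j` crosses at most one multiple of `r`, so at most two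
  -- neighbouring linear pieces of `φ` have to be compared.
  data Addition : ℕ → ℕ → Set where
    stay  : ∀ {s j} q → s < r → s + j < r → Addition (s + q * r) j
    carry : ∀ {s j t} q → s < r → t < r → s + j ≡ r + t → Addition (s + q * r) j

  addition : ∀ x {j} → j ≤ r → Addition x j
  addition x {j} j≤r = subst (λ y → Addition y j) (sym (m≡m%n+[m/n]*n x r)) (go (x / r) (m%n<n x r))
    where
    go : ∀ q {s} → s < r → Addition (s + q * r) j
    go q {s} s<r with s + j <? r
    ... | yes s+j<r = stay q s<r s+j<r
    ... | no  s+j≮r = carry q s<r t<r (sym (m+[n∸m]≡n (≮⇒≥ s+j≮r)))
      where
      t<r : s + j ∸ r < r
      t<r = +-cancelˡ-< r _ _ (≤-<-trans (≤-reflexive (m+[n∸m]≡n (≮⇒≥ s+j≮r))) (+-mono-<-≤ s<r j≤r))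

  φ-stay : ∀ q {s j} → s + j < r → φ (s + q * r + j) ≡ 2 ^ q * (r + (s + j))
  φ-stay q {s} {j} s+j<r = trans (cong φ (regroup s (q * r) j)) (φ-linear q s+j<r)
    where
    open +-*-Solver using (solve; _:=_; _:+_)
    regroup : ∀ s x j → s + x + j ≡ s + j + x
    regroup = solve 3 (λ s x j → s :+ x :+ j := s :+ j :+ x) refl

  φ-carry : ∀ q {s j t} → t < r → s + j ≡ r + t → φ (s + q * r + j) ≡ 2 ^ suc q * (r + t)
  φ-carry q {s} {j} {t} t<r s+j≡r+t = trans (cong φ regroup) (φ-linear (suc q) t<r)
    where
    open +-*-Solver using (solve; _:=_; _:+_)
    regroup : s + q * r + j ≡ t + (r + q * r)
    regroup = trans
      (solve 3 (λ s x j → s :+ x :+ j := s :+ j :+ x) refl s (q * r) j)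
      (trans (cong (_+ q * r) s+j≡r+t)
        (solve 3 (λ r t x → r :+ t :+ x := t :+ (r :+ x)) refl r t (q * r)))

  -- Within one linear piece the slack is proportional to j s. Across a breakpoint it is
  -- proportional to (r - s)(r - j), and `j ≤ r` keeps it nonnegative.
  φ-step : ∀ x {j} → j ≤ r → r * φ (x + j) ≤ (r + j) * φ x
  φ-step x {j} j≤r with addition x j≤r
  ... | stay {s} q s<r s+j<r rewrite φ-linear q s<r | φ-stay q {s} s+j<r =
    ≤-trans (m≤m+n _ (2 ^ q * (j * s))) (≤-reflexive (identity r s j (2 ^ q)))
    where
    open +-*-Solver using (solve; _:=_; _:+_; _:*_)
    identity : ∀ r s j p → r * (p * (r + (s + j))) + p * (j * s) ≡ (r + j) * (p * (r + s))
    identity = solve 4 (λ r s j p → r :* (p :* (r :+ (s :+ j))) :+ p :* (j :* s) := (r :+ j) :* (p :* (r :+ s))) refl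
  ... | carry {s} {t = t} q s<r t<r s+j≡r+t rewrite φ-linear q s<r | φ-carry q {s} t<r s+j≡r+t =
    subst₂ (λ r' j' → r' * (2 ^ suc q * (r' + t)) ≤ (r' + j') * (2 ^ q * (r' + s))) s+e≡r (sym j≡t+e)
      (subst (λ s' → (s' + e) * (2 ^ suc q * (s' + e + t)) ≤ (s' + e + (t + e)) * (2 ^ q * (s' + e + s'))) (sym s≡t+f)
        (≤-trans (m≤m+n _ (2 ^ q * (e * f))) (≤-reflexive (identity t e f (2 ^ q)))))
    where
    open +-*-Solver using (solve; _:=_; _:+_; _:*_; con)
    e = r ∸ s
    f = r ∸ j
    s+e≡r : s + e ≡ r
    s+e≡r = m+[n∸m]≡n (<⇒≤ s<r)
    j≡t+e : j ≡ t + e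
    j≡t+e = +-cancelˡ-≡ s _ _ (trans s+j≡r+t (trans (cong (_+ t) (sym s+e≡r))
      (trans (+-assoc s e t) (cong (s +_) (+-comm e t)))))
    s≡t+f : s ≡ t + f
    s≡t+f = +-cancelʳ-≡ j s (t + f) (trans s+j≡r+t (trans (+-comm r t)
      (trans (cong (t +_) (sym (m∸n+n≡m j≤r))) (sym (+-assoc t f j)))))
    -- (r - s)(r - j) ≥ 0 in the variables s = t + f, j = t + e, r = t + e + f
    identity : ∀ t e f p → (t + f + e) * (2 * p * (t + f + e + t)) + p * (e * f) ≡
                           (t + f + e + (t + e)) * (p * (t + f + e + (t + f)))
    identity = solve 4 (λ t e f p →
      (t :+ f :+ e) :* (con 2 :* p :* (t :+ f :+ e :+ t)) :+ p :* (e :* f) :=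
      (t :+ f :+ e :+ (t :+ e)) :* (p :* (t :+ f :+ e :+ (t :+ f)))) refl

  φ-mono : ∀ {x y} → x ≤ y → φ x ≤ φ y
  φ-mono {x} {y} x≤y = subst (λ z → φ x ≤ φ z) (m+[n∸m]≡n x≤y) (go (y ∸ x))
    where
    open ≤-Reasoning
    φ-suc : ∀ x → φ x ≤ φ (x + 1)
    φ-suc x with addition x (>-nonZero⁻¹ r)
    ... | stay {s} q s<r s+1<r rewrite φ-linear q s<r | φ-stay q {s} s+1<r =
      *-monoʳ-≤ (2 ^ q) (+-monoʳ-≤ r (m≤m+n s 1))
    ... | carry {s} {t = t} q s<r t<r eq rewrite φ-linear q s<r | φ-carry q {s} t<r eq = begin
      2 ^ q * (r + s)           ≤⟨ *-monoʳ-≤ (2 ^ q) (+-monoʳ-≤ r (<⇒≤ s<r)) ⟩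
      2 ^ q * (r + r)           ≡⟨ solve 2 (λ p r → p :* (r :+ r) := con 2 :* p :* r) refl (2 ^ q) r ⟩
      2 ^ suc q * r             ≤⟨ *-monoʳ-≤ (2 ^ suc q) (m≤m+n r t) ⟩
      2 ^ suc q * (r + t)       ∎
      where open +-*-Solver using (solve; _:=_; _:+_; _:*_; con)
    go : ∀ k → φ x ≤ φ (x + k)
    go zero    = ≤-reflexive (cong φ (sym (+-identityʳ x)))
    go (suc k) = ≤-trans (go k) (≤-trans (φ-suc (x + k))
      (≤-reflexive (cong φ (trans (+-assoc x k 1) (cong (x +_) (+-comm k 1))))))

-- Regular subgraphs from flows

opaque
  unfolding ∑∈

  ∑∈-∩ : ∀ {n} (S T : VertexSet n) f → ∑∈ T (λ u → ⟦ S u ⟧ * f u) ≡ ∑∈ (S ∩ T) f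
  ∑∈-∩ S T f = sum-cong-≗ pointwise
    where
    pointwise : ∀ u → ⟦ T u ⟧ * (⟦ S u ⟧ * f u) ≡ ⟦ S u ∧ T u ⟧ * f u
    pointwise u with S u | T u
    ... | true  | true  = +-identityʳ _
    ... | true  | false = refl
    ... | false | true  = refl
    ... | false | false = refl

  degree-deg : ∀ {n} (E : Relation n) v → degree E v ≡ deg E full v
  degree-deg E v = trans (sum-allFin (λ u → ⟦ E v u ⟧)) (sum-cong-≗ λ u → sym (*-identityˡ ⟦ E v u ⟧))

⟦∧⟧ : ∀ b c → ⟦ b ∧ c ⟧ ≡ ⟦ b ⟧ * ⟦ c ⟧
⟦∧⟧ true  c = sym (*-identityˡ ⟦ c ⟧)
⟦∧⟧ false c = refl

Disjoint : ∀ {n} → VertexSet n → VertexSet n → Set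
Disjoint A B = ∀ u → u ∈ A → B u ≡ false

deg≤size : ∀ {n} (E : Relation n) Y a → deg E Y a ≤ size Y
deg≤size E Y a = ∑∈-mono Y λ b _ → ⟦⟧≤1 (E a b)

module _ {n : ℕ} (G : Graph n) (r : ℕ) .{{_ : NonZero r}} where

  -- Every vertex of `B` receives `r` edges, so `A` sends out r |B| = r |A| edges; with at most `r`
  -- at each vertex of `A`, all of them have exactly `r`.
  regular-of-flow : ∀ {A B : VertexSet n} (H : Relation n) → Disjoint A B → size A ≡ size B → ∃ (_∈ A) →
    (∀ a b → H a b ≡ true → B b ∧ adj G a b ≡ true) → Flow A r (λ b → ⟦ B b ⟧ * r) H → HasRegularSubgraph r G
  regular-of-flow {A} {B} H disjoint size≡ (a₀ , a₀∈A) H⊆ (indeg≡ , deg≤r) =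
    A ∪ B , K , (a₀ , cong (_∨ B a₀) a₀∈A) , K-sym , K⊆G , K-support , K-degree
    where
    open ≡-Reasoning

    -- The flow conditions do not restrict edges that leave vertices outside `A`, so these are cut
    -- off before symmetrizing.
    K : Relation n
    K u v = (A u ∧ H u v) ∨ (A v ∧ H v u)

    ∨-true : ∀ b {c} → b ∨ c ≡ true → b ≡ true ⊎ c ≡ true
    ∨-true true  p = inj₁ refl
    ∨-true false p = inj₂ p

    K-sym : ∀ u v → K u v ≡ K v u
    K-sym u v = ∨-comm (A u ∧ H u v) (A v ∧ H v u)

    K⊆G : ∀ u v → K u v ≡ true → adj G u v ≡ true
    K⊆G u v p with ∨-true (A u ∧ H u v) p
    ... | inj₁ q = proj₂ (∧-true (H⊆ u v (proj₂ (∧-true q))))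
    ... | inj₂ q = trans (adj-sym G u v) (proj₂ (∧-true (H⊆ v u (proj₂ (∧-true q)))))

    H-support : ∀ {u v} → A u ∧ H u v ≡ true → (A ∪ B) u ≡ true × (A ∪ B) v ≡ true
    H-support {u} {v} q = cong (_∨ B u) (proj₁ (∧-true q)) ,
                          trans (cong (A v ∨_) (proj₁ (∧-true (H⊆ u v (proj₂ (∧-true q)))))) (∨-zeroʳ (A v))

    K-support : ∀ u v → K u v ≡ true → (A ∪ B) u ≡ true × (A ∪ B) v ≡ true
    K-support u v p with ∨-true (A u ∧ H u v) p
    ... | inj₁ q = H-support q
    ... | inj₂ q = proj₂ (H-support {v} {u} q) , proj₁ (H-support {v} {u} q)

    total : ∑∈ A (deg H full) ≡ ∑∈ A (λ _ → r)
    total = begin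
      ∑∈ A (deg H full)                    ≡⟨ ∑∈-comm A full (λ a b → ⟦ H a b ⟧) ⟩
      ∑∈ full (indeg A r (λ b → ⟦ B b ⟧ * r) H)    ≡⟨ ∑∈-cong full (λ b _ → indeg≡ b) ⟩
      ∑∈ full (λ b → ⟦ B b ⟧ * r)          ≡⟨ ∑∈-∩ B full (λ _ → r) ⟩
      ∑∈ (B ∩ full) (λ _ → r)              ≡⟨ ∑∈-const (B ∩ full) r ⟩
      r * size (B ∩ full)                  ≡⟨ cong (r *_) (≤-antisym (∑∈-⊆ (∩⊆ˡ B full) _) (∑∈-⊆ (λ u p → cong (_∧ true) p) _)) ⟩
      r * size B                           ≡⟨ cong (r *_) size≡ ⟨
      r * size A                           ≡⟨ ∑∈-const A r ⟨
      ∑∈ A (λ _ → r)                       ∎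

    deg≡r : ∀ a → a ∈ A → deg H full a ≡ r
    deg≡r = ∑∈-pointwise-≡ A deg≤r (≤-reflexive (sym total))

    K-degree : ∀ v → (A ∪ B) v ≡ true → degree K v ≡ r
    K-degree v v∈A∪B = trans (degree-deg K v) (K-deg v∈A∪B)
      where
      K-deg : (A ∪ B) v ≡ true → deg K full v ≡ r
      K-deg _ with A v in v∈A
      ... | true = trans (∑∈-cong full λ u _ → cong ⟦_⟧ (K-row u)) (deg≡r v v∈A)
        where
        K-row : ∀ u → H v u ∨ (A u ∧ H u v) ≡ H v u
        K-row u with H v u | H u v in Huv | A u
        ... | true  | _     | _     = refl
        ... | false | false | true  = refl
        ... | false | false | false = refl
        ... | false | true  | false = refl
        -- An edge of `H` into `v` would put `v` into `B`, which is disjoint from `A`.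
        ... | false | true  | true  =
          contradiction (trans (sym (disjoint v v∈A)) (proj₁ (∧-true (H⊆ u v Huv)))) λ ()
      K-deg v∈B | false = begin
        ∑∈ full (λ u → ⟦ A u ∧ H u v ⟧)    ≡⟨ ∑∈-cong full (λ u _ → ⟦∧⟧ (A u) (H u v)) ⟩
        ∑∈ full (λ u → ⟦ A u ⟧ * ⟦ H u v ⟧)        ≡⟨ ∑∈-∩ A full (λ u → ⟦ H u v ⟧) ⟩
        ∑∈ (A ∩ full) (λ u → ⟦ H u v ⟧)            ≡⟨ ≤-antisym (∑∈-⊆ (∩⊆ˡ A full) _) (∑∈-⊆ (λ u p → cong (_∧ true) p) _) ⟩
        ∑∈ A (λ u → ⟦ H u v ⟧)                     ≡⟨ indeg≡ v ⟩
        ⟦ B v ⟧ * r                                ≡⟨ cong (λ c → ⟦ c ⟧ * r) v∈B ⟩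
        1 * r                                      ≡⟨ *-identityˡ r ⟩
        r                                          ∎

  -- The effect of shrinking a pair on its weights

  module _ (d : ℕ) where

    -- The argument of φ is the number of neighbours that v lacks in B.
    weight : VertexSet n → Fin n → ℕ
    weight B v = φ r (d ∸ deg (adj G) B v)

    -- Passing from `B` to `B'` raises the number of missing neighbours by at most the degree into
    -- `Y`, also under truncated subtraction, so `φ-step` applies.
    weight-shrink : ∀ {B B' Y} → Split B B' Y → ∀ v → deg (adj G) Y v ≤ r →
      r * weight B' v ≤ (r + deg (adj G) Y v) * weight B v
    weight-shrink {B} {B'} {Y} split v deg≤r = begin
      r * φ r (d ∸ x)                 ≤⟨ *-monoʳ-≤ r (φ-mono r (m≤n+m∸n (d ∸ x) y)) ⟩
      r * φ r (y + (d ∸ x ∸ y))       ≡⟨ cong (λ k → r * φ r k) (+-comm y (d ∸ x ∸ y)) ⟩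
      r * φ r (d ∸ x ∸ y + y)         ≤⟨ φ-step r (d ∸ x ∸ y) deg≤r ⟩
      (r + y) * φ r (d ∸ x ∸ y)       ≡⟨ cong (λ k → (r + y) * φ r k) (∸-+-assoc d x y) ⟩
      (r + y) * φ r (d ∸ (x + y))     ≡⟨ cong (λ k → (r + y) * φ r (d ∸ k)) (∑∈-split split _) ⟨
      (r + y) * weight B v            ∎
      where
      open ≤-Reasoning
      x = deg (adj G) B' v
      y = deg (adj G) Y v

    potential : VertexSet n → VertexSet n → ℕ
    potential A B = ∑∈ A (weight B)

    -- The remaining weight is at most N r - N and grows by a factor of at most 1 + 1/r, while (r +
    -- 1)(N r - N) = N (r² - 1) is below r N r. The term `suc r * N` is carried on both sides to
    -- avoid subtraction.
    potential-removal : ∀ A B {a b N} → a ∈ A → b ∈ B → potential A B ≤ N * r → N ≤ weight B a →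
      potential (A ─ a) (B ─ b) ≤ N * r
    potential-removal A B {a} {b} {N} a∈A b∈B pot≤ N≤w =
      *-cancelˡ-≤ r (+-cancelʳ-≤ (suc r * N) _ _ (begin
        r * potential A' B' + suc r * N                 ≡⟨ cong (_+ suc r * N) (∑∈-distribˡ-* A' r (weight B')) ⟨
        ∑∈ A' (λ u → r * weight B' u) + suc r * N       ≤⟨ +-mono-≤ (∑∈-mono A' λ u _ → increment u) (*-monoʳ-≤ (suc r) N≤w) ⟩
        ∑∈ A' (λ u → suc r * weight B u) + suc r * weight B a
                                                        ≡⟨ cong (_+ suc r * weight B a) (∑∈-distribˡ-* A' (suc r) (weight B)) ⟩
        suc r * potential A' B + suc r * weight B a     ≡⟨ *-distribˡ-+ (suc r) (potential A' B) (weight B a) ⟨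
        suc r * (potential A' B + weight B a)           ≡⟨ cong (suc r *_) (∑∈-remove {S = A} a∈A (weight B)) ⟨
        suc r * potential A B                           ≤⟨ *-monoʳ-≤ (suc r) pot≤ ⟩
        suc r * (N * r)                                 ≡⟨ solve 2 (λ r N → (con 1 :+ r) :* (N :* r) := r :* (N :* r) :+ r :* N) refl r N ⟩
        r * (N * r) + r * N                             ≤⟨ +-monoʳ-≤ (r * (N * r)) (*-monoˡ-≤ N (n≤1+n r)) ⟩
        r * (N * r) + suc r * N                         ∎))
      where
      open ≤-Reasoning
      open +-*-Solver using (solve; _:=_; _:+_; _:*_; con)
      A' = A ─ a
      B' = B ─ b
      deg≤1 : ∀ u → deg (adj G) (point b) u ≤ 1
      deg≤1 u = ≤-trans (≤-reflexive (∑∈-point b _)) (⟦⟧≤1 (adj G u b))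
      increment : ∀ u → r * weight B' u ≤ suc r * weight B u
      increment u = ≤-trans
        (weight-shrink (─-split b∈B) u (≤-trans (deg≤1 u) (>-nonZero⁻¹ r)))
        (*-monoˡ-≤ (weight B u) (≤-trans (+-monoʳ-≤ r (deg≤1 u)) (≤-reflexive (+-comm r 1))))

-- Descent on the size of the pair

does-true : ∀ {P : Set} (p : Dec P) → does p ≡ true → P
does-true (yes p) _ = p

does-false : ∀ {P : Set} (p : Dec P) → does p ≡ false → ¬ P
does-false (no ¬p) _ = ¬p

module _ {n : ℕ} (G : Graph n) (r : ℕ) .{{_ : NonZero r}} (d : ℕ) where

    -- What a deficient `Y` yields: the last component is the smaller balanced pair, the middle one
    -- its strict decrease in size, and the first a vertex that would be too heavy if the smaller
    -- pair had fewer than `r` vertices on a side.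
    Cut : VertexSet n → VertexSet n → VertexSet n → ℕ → Set
    Cut A B Y N = (∃ λ x → x ∈ A × deg (adj G) Y x < r) × size (B ∖ Y) < size A ×
      (∃ λ X → X ⊆ A × size X ≡ size (B ∖ Y) × potential G r d X (B ∖ Y) ≤ N * r)

    potential-cut : ∀ A B Y {N} → size A ≡ size B → Y ⊆ B → ∑∈ A (λ a → r ⊓ deg (adj G) Y a) < r * size Y →
      potential G r d A B ≤ N * r → Cut A B Y N
    potential-cut A B Y {N} size≡ Y⊆B deficient pot≤ =
      witness , ≤-trans B'<X (∑∈-⊆ X⊆A _) , X₀ , (λ u u∈X₀ → X⊆A u (X₀⊆X u u∈X₀)) , size-X₀ , potential-X₀
      where
      open ≤-Reasoning
      w = weight G r d B
      B' = B ∖ Y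
      degY = deg (adj G) Y

      X : VertexSet n
      X u = A u ∧ does (degY u <? r)

      X⊆A : X ⊆ A
      X⊆A u p = proj₁ (∧-true p)

      deg<r : ∀ u → u ∈ X → degY u < r
      deg<r u p = does-true (degY u <? r) (proj₂ (∧-true p))

      r≤deg : ∀ u → u ∈ (A ∖ X) → r ≤ degY u
      r≤deg u p = ≮⇒≥ (does-false (degY u <? r) (go (A u) _ p))
        where
        go : ∀ b c → b ∧ not (b ∧ c) ≡ true → c ≡ false
        go true false _ = refl

      -- Vertices of `A` outside `X` contribute `r` each to the truncated sum. With |A| = |B|, the
      -- deficiency of `Y` becomes e(X, Y) + r |B'| < r |X|.
      X-edges : ∑∈ X degY + r * size B' < r * size X
      X-edges = +-cancelʳ-< (r * size Y) _ _ (begin-strict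
        ∑∈ X degY + r * size B' + r * size Y       ≡⟨ +-assoc (∑∈ X degY) _ _ ⟩
        ∑∈ X degY + (r * size B' + r * size Y)     ≡⟨ cong (∑∈ X degY +_) (*-distribˡ-+ r _ _) ⟨
        ∑∈ X degY + r * (size B' + size Y)         ≡⟨ cong (λ k → ∑∈ X degY + r * k) (∑∈-split (∖-split Y⊆B) _) ⟨
        ∑∈ X degY + r * size B                     ≡⟨ cong (λ k → ∑∈ X degY + r * k) size≡ ⟨
        ∑∈ X degY + r * size A                     ≡⟨ cong (λ k → ∑∈ X degY + r * k) (∑∈-split A-split _) ⟩
        ∑∈ X degY + r * (size (A ∖ X) + size X)    ≡⟨ solve 4 (λ e r a x → e :+ r :* (a :+ x) := r :* x :+ (r :* a :+ e)) refl (∑∈ X degY) r (size (A ∖ X)) (size X) ⟩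
        r * size X + (r * size (A ∖ X) + ∑∈ X degY)   ≡⟨ cong (λ k → r * size X + (k + ∑∈ X degY)) (∑∈-const (A ∖ X) r) ⟨
        r * size X + (∑∈ (A ∖ X) (λ _ → r) + ∑∈ X degY)
          ≤⟨ +-monoʳ-≤ (r * size X) (+-mono-≤
               (∑∈-mono (A ∖ X) λ u p → ≤-reflexive (sym (m≤n⇒m⊓n≡m (r≤deg u p))))
               (∑∈-mono X λ u p → ≤-reflexive (sym (m≥n⇒m⊓n≡n (<⇒≤ (deg<r u p)))))) ⟩
        r * size X + (∑∈ (A ∖ X) (λ u → r ⊓ degY u) + ∑∈ X (λ u → r ⊓ degY u))
          ≡⟨ cong (r * size X +_) (∑∈-split A-split _) ⟨
        r * size X + ∑∈ A (λ u → r ⊓ degY u)       <⟨ +-monoʳ-< (r * size X) deficient ⟩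
        r * size X + r * size Y                    ∎)
        where
        open +-*-Solver using (solve; _:=_; _:+_; _:*_)
        A-split : Split A (A ∖ X) X
        A-split = ∖-split X⊆A

      B'<X : size B' < size X
      B'<X = *-cancelˡ-< r _ _ (≤-<-trans (m≤n+m _ (∑∈ X degY)) X-edges)

      witness : ∃ λ x → x ∈ A × degY x < r
      witness with x , x∈X ← size-positive X (≤-trans (s≤s z≤n) B'<X) = x , X⊆A x x∈X , deg<r x x∈X

      k = size X ∸ size B'

      selection = dropLargest X w k (m∸n≤m (size X) (size B'))
      X₀ = proj₁ selection
      θ = proj₁ (proj₂ selection)

      X₀⊆X : X₀ ⊆ X
      X₀⊆X = proj₁ (proj₂ (proj₂ selection))

      size-X₀ : size X₀ ≡ size B'
      size-X₀ = +-cancelʳ-≡ k _ _ (trans (proj₁ (proj₂ (proj₂ (proj₂ selection)))) (sym (m+[n∸m]≡n (<⇒≤ B'<X))))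

      removed : ∑∈ X₀ w + θ * k ≤ ∑∈ X w
      removed = proj₁ (proj₂ (proj₂ (proj₂ (proj₂ selection))))

      w≤θ : ∀ u → u ∈ X₀ → w u ≤ θ
      w≤θ = proj₂ (proj₂ (proj₂ (proj₂ (proj₂ selection))))

      edges≤ : ∑∈ X degY ≤ r * k
      edges≤ = +-cancelʳ-≤ (r * size B') _ _ (begin
        ∑∈ X degY + r * size B'         ≤⟨ <⇒≤ X-edges ⟩
        r * size X                      ≡⟨ cong (r *_) (m∸n+n≡m (<⇒≤ B'<X)) ⟨
        r * (k + size B')               ≡⟨ *-distribˡ-+ r k (size B') ⟩
        r * k + r * size B'             ∎)

      -- The k heaviest vertices of X weigh at least θ each, which pays for the at most r k edges
      -- that the remaining vertices, of weight at most θ, lose.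
      potential-X₀ : potential G r d X₀ B' ≤ N * r
      potential-X₀ = *-cancelˡ-≤ r (begin
        r * potential G r d X₀ B'                       ≡⟨ ∑∈-distribˡ-* X₀ r _ ⟨
        ∑∈ X₀ (λ u → r * weight G r d B' u)             ≤⟨ ∑∈-mono X₀ (λ u p → shrink u p) ⟩
        ∑∈ X₀ (λ u → r * w u + θ * degY u)              ≡⟨ ∑∈-distrib-+ X₀ _ _ ⟩
        ∑∈ X₀ (λ u → r * w u) + ∑∈ X₀ (λ u → θ * degY u)
                                                        ≡⟨ cong₂ _+_ (∑∈-distribˡ-* X₀ r w) (∑∈-distribˡ-* X₀ θ degY) ⟩
        r * ∑∈ X₀ w + θ * ∑∈ X₀ degY                    ≤⟨ +-monoʳ-≤ (r * ∑∈ X₀ w) (*-monoʳ-≤ θ (≤-trans (∑∈-⊆ X₀⊆X degY) edges≤)) ⟩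
        r * ∑∈ X₀ w + θ * (r * k)                       ≡⟨ solve 4 (λ r s t k → r :* s :+ t :* (r :* k) := r :* (s :+ t :* k)) refl r (∑∈ X₀ w) θ k ⟩
        r * (∑∈ X₀ w + θ * k)                           ≤⟨ *-monoʳ-≤ r removed ⟩
        r * ∑∈ X w                                      ≤⟨ *-monoʳ-≤ r (≤-trans (∑∈-⊆ X⊆A w) pot≤) ⟩
        r * (N * r)                                     ∎)
        where
        open +-*-Solver using (solve; _:=_; _:+_; _:*_)
        shrink : ∀ u → u ∈ X₀ → r * weight G r d B' u ≤ r * w u + θ * degY u
        shrink u p = begin
          r * weight G r d B' u          ≤⟨ weight-shrink G r d (∖-split Y⊆B) u (<⇒≤ (deg<r u (X₀⊆X u p))) ⟩
          (r + degY u) * w u             ≡⟨ solve 3 (λ r e w → (r :+ e) :* w := r :* w :+ w :* e) refl r (degY u) (w u) ⟩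
          r * w u + w u * degY u         ≤⟨ +-monoʳ-≤ (r * w u) (*-monoˡ-≤ (degY u) (w≤θ u p)) ⟩
          r * w u + θ * degY u           ∎

    -- The relation keeps only edges into `B` and demands vanish outside `B`, so a violating set may
    -- be cut down to its part in `B`.
    violator-deficient : ∀ A B Y → Violates A r (λ b → ⟦ B b ⟧ * r) (λ a b → B b ∧ adj G a b) Y →
      ∑∈ A (λ a → r ⊓ deg (adj G) (B ∩ Y) a) < r * size (B ∩ Y)
    violator-deficient A B Y viol = begin-strict
      ∑∈ A (λ a → r ⊓ deg (adj G) (B ∩ Y) a)
        ≡⟨ ∑∈-cong A (λ a _ → cong (r ⊓_) (trans (∑∈-cong Y λ b _ → ⟦∧⟧ (B b) (adj G a b)) (∑∈-∩ B Y _))) ⟨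
      ∑∈ A (λ a → r ⊓ deg (λ a b → B b ∧ adj G a b) Y a)   <⟨ viol ⟩
      ∑∈ Y (λ b → ⟦ B b ⟧ * r)                             ≡⟨ ∑∈-∩ B Y (λ _ → r) ⟩
      ∑∈ (B ∩ Y) (λ _ → r)                                 ≡⟨ ∑∈-const (B ∩ Y) r ⟩
      r * size (B ∩ Y)                                     ∎
      where open ≤-Reasoning

    -- A weight of `N` is at least a 1/r fraction of a potential bounded by `N * r`. The hypotheses
    -- give at least `N` to vertices with at most 2r neighbours in `B`, and more than `N` to those
    -- with at most `r`.
    module _ {N} (N≤φ : N ≤ φ r (d ∸ (r + r))) (N<φ : N < φ r (d ∸ r)) where

      record Balanced (m : ℕ) : Set where
        field
          A B        : VertexSet n
          disjoint   : Disjoint A B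
          size-A     : size A ≡ m
          size-B     : size B ≡ m
          potential≤ : potential G r d A B ≤ N * r

      open Balanced

      Smaller : ℕ → Set
      Smaller m = ∃ λ m' → m' < m × r ≤ m' × Balanced m'

      -- Dropping one vertex of B scales the other weights by at most 1 + 1/r, which the loss of a
      -- vertex of weight N out of a total of N r compensates.
      discard-heavy : ∀ {m} → r ≤ m → (s : Balanced m) → (∃ λ a → a ∈ A s × N ≤ weight G r d (B s) a) → Smaller m
      discard-heavy {m} r≤m s (a , a∈A , N≤w) with m ≤? r
      -- Here m = r, so no vertex has more than `r` neighbours in `B`; each of the `r` vertices of
      -- `A` weighs more than `N`, against the bound on the potential.
      ... | yes m≤r = contradiction (potential≤ s) (<⇒≱ (begin-strict
        N * r                          <⟨ *-monoˡ-< r (n<1+n N) ⟩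
        suc N * r                      ≤⟨ *-monoʳ-≤ (suc N) r≤m ⟩
        suc N * m                      ≡⟨ cong (suc N *_) (size-A s) ⟨
        suc N * size (A s)             ≡⟨ ∑∈-const (A s) (suc N) ⟨
        ∑∈ (A s) (λ _ → suc N)         ≤⟨ ∑∈-mono (A s) (λ u _ → heavy u) ⟩
        potential G r d (A s) (B s)    ∎))
        where
        open ≤-Reasoning
        heavy : ∀ u → N < weight G r d (B s) u
        heavy u = ≤-trans N<φ (φ-mono r (∸-monoʳ-≤ d
          (≤-trans (deg≤size (adj G) (B s) u) (≤-trans (≤-reflexive (size-B s)) m≤r))))
      ... | no m≰r = remove m refl (size-positive (B s) (≤-trans (>-nonZero⁻¹ r) (≤-trans r≤m (≤-reflexive (sym (size-B s))))))
        where
        remove : ∀ k → m ≡ k → ∃ (_∈ B s) → Smaller k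
        remove zero    m≡k _          = contradiction (≤-trans (≤-reflexive m≡k) z≤n) m≰r
        remove (suc k) m≡k (b , b∈B) = k , ≤-refl , s≤s⁻¹ (≤-trans (≰⇒> m≰r) (≤-reflexive m≡k)) , record
          { A          = A s ─ a
          ; B          = B s ─ b
          ; disjoint   = λ u p → cong (_∧ not (point b u)) (disjoint s u (∖⊆ (A s) (point a) u p))
          ; size-A     = suc-injective (trans (sym (size-remove {S = A s} a∈A)) (trans (size-A s) m≡k))
          ; size-B     = suc-injective (trans (sym (size-remove {S = B s} b∈B)) (trans (size-B s) m≡k))
          ; potential≤ = potential-removal G r d (A s) (B s) a∈A b∈B (potential≤ s) N≤w
          }

      restrict-to-cut : ∀ {m} → (s : Balanced m) → ¬ (∃ λ a → a ∈ A s × N ≤ weight G r d (B s) a) →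
        ∀ Y → Y ⊆ B s → Cut (A s) (B s) Y N → Smaller m
      restrict-to-cut {m} s light Y Y⊆B ((x , x∈A , deg<r) , smaller , X , X⊆A , size-X , pot-X)
        with r ≤? size (B s ∖ Y)
      ... | yes r≤size = size (B s ∖ Y) , ≤-trans smaller (≤-reflexive (size-A s)) , r≤size , record
        { A          = X
        ; B          = B s ∖ Y
        ; disjoint   = λ u u∈X → cong (_∧ not (Y u)) (disjoint s u (X⊆A u u∈X))
        ; size-A     = size-X
        ; size-B     = refl
        ; potential≤ = pot-X
        }
      -- Now `x` has at most `r` neighbours in `B` outside `Y` and fewer than `r` in `Y`, so it
      -- would be heavy.
      ... | no r≰size = contradiction (x , x∈A , ≤-trans N≤φ (φ-mono r (∸-monoʳ-≤ d (begin
        deg (adj G) (B s) x                                ≡⟨ ∑∈-split (∖-split Y⊆B) _ ⟩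
        deg (adj G) (B s ∖ Y) x + deg (adj G) Y x          ≤⟨ +-mono-≤ (≤-trans (deg≤size (adj G) (B s ∖ Y) x) (<⇒≤ (≰⇒> r≰size))) (<⇒≤ deg<r) ⟩
        r + r                                              ∎)))) light
        where open ≤-Reasoning

      flow-or-smaller : ∀ {m} → r ≤ m → (s : Balanced m) → ¬ (∃ λ a → a ∈ A s × N ≤ weight G r d (B s) a) →
        HasRegularSubgraph r G ⊎ Smaller m
      flow-or-smaller {m} r≤m s light = Sum.map
        (λ (H , H⊆ , flow) → regular-of-flow G r H (disjoint s) size≡ nonempty H⊆ flow)
        (λ (Y , viol) → restrict-to-cut s light (B s ∩ Y) (∩⊆ˡ (B s) Y)
          (potential-cut (A s) (B s) (B s ∩ Y) {N} size≡ (∩⊆ˡ (B s) Y) (violator-deficient (A s) (B s) Y viol) (potential≤ s)))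
        (flow-or-violator (A s) r (λ b → ⟦ B s b ⟧ * r) (λ a b → B s b ∧ adj G a b))
        where
        size≡ : size (A s) ≡ size (B s)
        size≡ = trans (size-A s) (sym (size-B s))
        nonempty : ∃ (_∈ A s)
        nonempty = size-positive (A s) (≤-trans (>-nonZero⁻¹ r) (≤-trans r≤m (≤-reflexive (sym (size-A s)))))

      -- Heavy vertices are discarded first, because their absence is what keeps the pair left by a
      -- cut from having fewer than `r` vertices on a side.
      step : ∀ {m} → r ≤ m → Balanced m → HasRegularSubgraph r G ⊎ Smaller m
      step r≤m s with any? (λ a → (A s a ≟ᵇ true) ×-dec (N ≤? weight G r d (B s) a))
      ... | yes heavy = inj₂ (discard-heavy r≤m s heavy)
      ... | no  light = flow-or-smaller r≤m s light

      descent : ∀ {m} → r ≤ m → Balanced m → HasRegularSubgraph r G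
      descent {m} r≤m s = go m ≤-refl r≤m s
        where
        go : ∀ k {m} → m ≤ k → r ≤ m → Balanced m → HasRegularSubgraph r G
        continue : ∀ k {m} → m ≤ suc k → HasRegularSubgraph r G ⊎ Smaller m → HasRegularSubgraph r G

        go zero    m≤k r≤m s = contradiction (≤-trans r≤m m≤k) (<⇒≱ (>-nonZero⁻¹ r))
        go (suc k) m≤k r≤m s = continue k m≤k (step r≤m s)

        continue k m≤k (inj₁ regular)               = regular
        continue k m≤k (inj₂ (m' , m'<m , r≤m' , s)) = go k (s≤s⁻¹ (≤-trans m'<m m≤k)) r≤m' s

-- A balanced pair of large minimum degree

opaque
  unfolding ∑∈

  size-full : ∀ n → size (full {n}) ≡ n
  size-full zero    = refl
  size-full (suc n) = cong suc (size-full n)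

  degreeSum-deg : ∀ {n} (G : Graph n) → degreeSum G ≡ ∑∈ full (deg (adj G) full)
  degreeSum-deg G = trans (sum-allFin (degree (adj G)))
    (sum-cong-≗ λ v → trans (degree-deg (adj G) v) (sym (*-identityˡ (deg (adj G) full v))))

split-disjoint : ∀ {n} {S P Q : VertexSet n} → Split S P Q → Disjoint P Q
split-disjoint {S = S} {P} {Q} split u u∈P = go (S u) (P u) (Q u) (indicator split u) u∈P
  where
  go : ∀ s p q → ⟦ s ⟧ ≡ ⟦ p ⟧ + ⟦ q ⟧ → p ≡ true → q ≡ false
  go _     true false _  _ = refl
  go true  true true  () _
  go false true true  () _

split-swap : ∀ {n} {S P Q : VertexSet n} → Split S P Q → Split S Q P
split-swap {P = P} {Q} split = split-by λ u → trans (indicator split u) (+-comm ⟦ P u ⟧ ⟦ Q u ⟧)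

split-⊆ : ∀ {n} {S P Q : VertexSet n} → Split S P Q → P ⊆ S
split-⊆ {S = S} {P} {Q} split u u∈P = go (S u) (P u) (Q u) (indicator split u) u∈P
  where
  go : ∀ s p q → ⟦ s ⟧ ≡ ⟦ p ⟧ + ⟦ q ⟧ → p ≡ true → s ≡ true
  go true  true _ _  _ = refl
  go false true _ () _

split-move : ∀ {n} {U P Q : VertexSet n} → Split U P Q → ∀ {v} → v ∈ P → Split (Q ∪ point v) Q (point v) × Split U (P ─ v) (Q ∪ point v)
split-move {U = U} {P} {Q} split {v} v∈P = Q∪v , split-by λ u → begin
  ⟦ U u ⟧                                        ≡⟨ indicator split u ⟩
  ⟦ P u ⟧ + ⟦ Q u ⟧                              ≡⟨ cong (_+ ⟦ Q u ⟧) (indicator (─-split {S = P} v∈P) u) ⟩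
  ⟦ (P ─ v) u ⟧ + ⟦ point v u ⟧ + ⟦ Q u ⟧        ≡⟨ +-assoc ⟦ (P ─ v) u ⟧ _ _ ⟩
  ⟦ (P ─ v) u ⟧ + (⟦ point v u ⟧ + ⟦ Q u ⟧)      ≡⟨ cong (⟦ (P ─ v) u ⟧ +_) (trans (+-comm ⟦ point v u ⟧ _) (sym (indicator Q∪v u))) ⟩
  ⟦ (P ─ v) u ⟧ + ⟦ (Q ∪ point v) u ⟧            ∎
  where
  open ≡-Reasoning
  Q∪v : Split (Q ∪ point v) Q (point v)
  Q∪v = split-by pointwise
    where
    pointwise : ∀ u → ⟦ Q u ∨ point v u ⟧ ≡ ⟦ Q u ⟧ + ⟦ point v u ⟧
    pointwise u with u ≟ᶠ v
    ... | yes u≡v rewrite trans (cong Q u≡v) (split-disjoint split v v∈P) = refl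
    ... | no _ with Q u
    ...   | true  = refl
    ...   | false = refl

module _ {n : ℕ} (G : Graph n) where

  d[_] : VertexSet n → Fin n → ℕ
  d[ S ] = deg (adj G) S

  cross : VertexSet n → VertexSet n → ℕ
  cross P Q = ∑∈ P d[ Q ]

  cross-comm : ∀ P Q → cross P Q ≡ cross Q P
  cross-comm P Q = trans (∑∈-comm P Q (λ u v → ⟦ adj G u v ⟧))
    (∑∈-cong Q λ v _ → ∑∈-cong P λ u _ → cong ⟦_⟧ (adj-sym G u v))

  -- Deleting a vertex of degree below `D` removes less than 2D from the degree sum, so the average
  -- stays at least 2D.
  min-degree-subgraph : ∀ D k U → size U ≤ k → ∃ (_∈ U) → 2 * D * size U ≤ cross U U →
    ∃ λ U' → ∃ (_∈ U') × (∀ v → v ∈ U' → D ≤ d[ U' ] v)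
  min-degree-subgraph D k U size≤ nonempty dense
    with any? (λ v → (U v ≟ᵇ true) ×-dec (d[ U ] v <? D))
  ... | no none = U , nonempty , λ v v∈U → ≮⇒≥ λ lt → none (v , v∈U , lt)
  min-degree-subgraph D zero    U size≤ _ dense | yes (v , v∈U , _) =
    contradiction (≤-trans (term≤∑∈ U (λ _ → 1) v∈U) size≤) λ ()
  min-degree-subgraph D (suc k) U size≤ _ dense | yes (v , v∈U , low) =
    min-degree-subgraph D k U' (s≤s⁻¹ (≤-trans (≤-reflexive (sym size≡)) size≤))
      nonempty' (<⇒≤ dense')
    where
    open ≤-Reasoning
    U' = U ─ v
    size≡ : size U ≡ suc (size U')
    size≡ = size-remove {S = U} v∈U
    -- Strictness makes the degree sum of `U'` positive, which shows `U'` to be non-empty.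
    dense' : 2 * D * size U' < cross U' U'
    dense' = +-cancelʳ-< (2 * D) _ _ (begin-strict
      2 * D * size U' + 2 * D                    ≡⟨ +-comm (2 * D * size U') (2 * D) ⟩
      2 * D + 2 * D * size U'                    ≡⟨ *-suc (2 * D) (size U') ⟨
      2 * D * suc (size U')                      ≡⟨ cong (2 * D *_) size≡ ⟨
      2 * D * size U                             ≤⟨ dense ⟩
      cross U U                                  ≡⟨ ∑∈-remove {S = U} v∈U d[ U ] ⟩
      cross U' U + d[ U ] v                      ≡⟨ cong (_+ d[ U ] v) (cross-comm U' U) ⟩
      cross U U' + d[ U ] v                      ≡⟨ cong (_+ d[ U ] v) (∑∈-remove {S = U} v∈U d[ U' ]) ⟩
      cross U' U' + d[ U' ] v + d[ U ] v         ≡⟨ +-assoc (cross U' U') _ _ ⟩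
      cross U' U' + (d[ U' ] v + d[ U ] v)       <⟨ +-monoʳ-< (cross U' U') (+-mono-≤-< (≤-trans (∑∈-⊆ (∖⊆ U (point v)) _) (<⇒≤ low)) low) ⟩
      cross U' U' + (D + D)                      ≡⟨ cong (λ x → cross U' U' + (D + x)) (+-identityʳ D) ⟨
      cross U' U' + 2 * D                        ∎)
    nonempty' : ∃ (_∈ U')
    nonempty' with x , x∈U' , _ ← ∑∈-positive U' d[ U' ] (≤-trans (s≤s z≤n) dense') = x , x∈U'

  -- Moving `v` trades its `d[ Q ] v` crossing edges for `d[ P ] v` new ones; as `v` is not adjacent
  -- to itself, the latter number is the same for `P` and for `P ─ v`.
  cross-move : ∀ {U P Q} → Split U P Q → ∀ {v} → v ∈ P → d[ Q ] v < d[ P ] v →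
    cross P Q < cross (P ─ v) (Q ∪ point v)
  cross-move {U} {P} {Q} split {v} v∈P gain = begin-strict
    cross P Q                     ≡⟨ ∑∈-remove {S = P} v∈P d[ Q ] ⟩
    cross P' Q + d[ Q ] v         <⟨ +-monoʳ-< (cross P' Q) gain ⟩
    cross P' Q + d[ P ] v         ≡⟨ cong (cross P' Q +_) (∑∈-remove {S = P} v∈P (λ u → ⟦ adj G v u ⟧)) ⟩
    cross P' Q + (d[ P' ] v + ⟦ adj G v v ⟧)
                                  ≡⟨ cong (λ b → cross P' Q + (d[ P' ] v + ⟦ b ⟧)) (irrefl G v) ⟩
    cross P' Q + (d[ P' ] v + 0)  ≡⟨ cong₂ _+_ (cross-comm P' Q) (+-identityʳ _) ⟩
    cross Q P' + d[ P' ] v        ≡⟨ cong (cross Q P' +_) (∑∈-point v d[ P' ]) ⟨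
    cross Q P' + cross (point v) P'
                                  ≡⟨ ∑∈-split (proj₁ (split-move split v∈P)) d[ P' ] ⟨
    cross Q' P'                   ≡⟨ cross-comm Q' P' ⟩
    cross P' Q'                   ∎
    where
    open ≤-Reasoning
    P' = P ─ v
    Q' = Q ∪ point v

  cross≤ : ∀ {U P Q} → Split U P Q → cross P Q ≤ cross U U
  cross≤ {U} {P} {Q} split = ≤-trans (∑∈-⊆ (split-⊆ split) d[ Q ])
    (∑∈-mono U λ u _ → ∑∈-⊆ (split-⊆ (split-swap split)) _)

  -- A vertex with more neighbours on its own side is moved across. Each move gains crossing edges,
  -- and `k` bounds how far their number is below its ceiling `cross U U`. A move out of `Q` also
  -- swaps the sides, which the symmetric conclusion allows.
  local-max-cut : ∀ U k P Q → Split U P Q → cross U U ≤ cross P Q + k →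
    ∃ λ P → ∃ λ Q → Split U P Q × (∀ v → v ∈ P → d[ P ] v ≤ d[ Q ] v) × (∀ v → v ∈ Q → d[ Q ] v ≤ d[ P ] v)
  local-max-cut U k P Q split bound
    with any? (λ v → (P v ≟ᵇ true) ×-dec (d[ Q ] v <? d[ P ] v))
       | any? (λ v → (Q v ≟ᵇ true) ×-dec (d[ P ] v <? d[ Q ] v))
  ... | no noneP | no noneQ = P , Q , split ,
    (λ v v∈P → ≮⇒≥ λ lt → noneP (v , v∈P , lt)) , (λ v v∈Q → ≮⇒≥ λ lt → noneQ (v , v∈Q , lt))
  local-max-cut U zero P Q split bound | yes (v , v∈P , gain) | _ = contradiction
    (≤-trans (cross-move split v∈P gain)
      (≤-trans (cross≤ (proj₂ (split-move split v∈P)))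
        (≤-trans bound (≤-reflexive (+-identityʳ _))))) (<-irrefl refl)
  local-max-cut U (suc k) P Q split bound | yes (v , v∈P , gain) | _ =
    local-max-cut U k (P ─ v) (Q ∪ point v) (proj₂ (split-move split v∈P))
      (≤-trans bound (≤-trans (≤-reflexive (+-suc _ k)) (+-monoˡ-≤ k (cross-move split v∈P gain))))
  local-max-cut U zero P Q split bound | no _ | yes (v , v∈Q , gain) = contradiction
    (≤-trans (cross-move (split-swap split) v∈Q gain)
      (≤-trans (cross≤ (proj₂ (split-move (split-swap split) v∈Q)))
        (≤-trans bound (≤-reflexive (trans (+-identityʳ _) (cross-comm P Q)))))) (<-irrefl refl)
  local-max-cut U (suc k) P Q split bound | no _ | yes (v , v∈Q , gain) =
    local-max-cut U k (Q ─ v) (P ∪ point v) (proj₂ (split-move (split-swap split) v∈Q))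
      (≤-trans bound (≤-trans (≤-reflexive (trans (+-suc _ k) (cong (λ x → suc (x + k)) (cross-comm P Q))))
        (+-monoˡ-≤ k (cross-move (split-swap split) v∈Q gain))))

-- Integer logarithms and the choice of parameters

powerOfTwoBelow : ∀ r n .{{_ : NonZero r}} → 2 * r ≤ n → ∃ λ p → 1 ≤ p × 2 ^ p * r ≤ n × n < 2 ^ suc p * r
-- `p` is the integer part of log₂(n/r), searched for upwards from 1, which `2 * r ≤ n` permits.
-- Fuel `n` suffices because n < 2^n.
powerOfTwoBelow r n 2r≤n = go n 1 ≤-refl 2r≤n (≤-trans (n<2^n n) (≤-trans (^-monoʳ-≤ 2 (m≤n+m n 1))
  (≤-trans (≤-reflexive (cong (2 ^_) (+-comm 1 n))) (m≤m*n _ r))))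
  where
  n<2^n : ∀ n → n < 2 ^ n
  n<2^n zero    = s≤s z≤n
  n<2^n (suc n) = +-mono-≤ (m^n>0 2 n) (≤-trans (n<2^n n) (m≤m+n (2 ^ n) 0))
  go : ∀ k p → 1 ≤ p → 2 ^ p * r ≤ n → n < 2 ^ (k + p) * r → ∃ λ p → 1 ≤ p × 2 ^ p * r ≤ n × n < 2 ^ suc p * r
  go zero    p 1≤p low high = contradiction low (<⇒≱ high)
  go (suc k) p 1≤p low high with n <? 2 ^ suc p * r
  ... | yes n<   = p , 1≤p , low , n<
  ... | no  n≮   = go k (suc p) (s≤s z≤n) (≮⇒≥ n≮) (≤-trans high (≤-reflexive (cong (λ e → 2 ^ e * r) (sym (+-suc k p)))))

^-distribʳ-* : ∀ x y e → (x * y) ^ e ≡ x ^ e * y ^ e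
^-distribʳ-* x y zero    = refl
^-distribʳ-* x y (suc e) = trans (cong (x * y *_) (^-distribʳ-* x y e)) ([m*n]*[o*p]≡[m*o]*[n*p] x y (x ^ e) (y ^ e))

-- Raising `2 ^ p * r ≤ n` to the power `C * r * n`, cancelling the power of `r` and comparing
-- exponents of 2 puts `p` in place of the logarithm.
degreeSum-large : ∀ {n} C r p .{{_ : NonZero r}} (G : Graph n) → AvgDegreeCondition C r G → 2 ^ p * r ≤ n →
  p * (C * r * n) ≤ degreeSum G
degreeSum-large {n} C r p G condition low = ≮⇒≥ λ lt → contradiction powers (<⇒≱ (^-monoʳ-< 2 (s≤s (s≤s z≤n)) lt))
  where
  open ≤-Reasoning
  e = C * r * n
  powers : 2 ^ (p * e) ≤ 2 ^ degreeSum G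
  powers = *-cancelʳ-≤ _ _ (r ^ e) {{m^n≢0 r e}} (begin
    2 ^ (p * e) * r ^ e          ≡⟨ cong (_* r ^ e) (^-*-assoc 2 p e) ⟨
    (2 ^ p) ^ e * r ^ e          ≡⟨ ^-distribʳ-* (2 ^ p) r e ⟨
    (2 ^ p * r) ^ e              ≤⟨ ^-monoˡ-≤ e low ⟩
    n ^ e                        ≤⟨ condition ⟩
    2 ^ degreeSum G * r ^ e      ∎)

-- The descent runs with `N` equal to `n`: at the start no vertex of `A` has a shortage, so each
-- weighs `φ r 0`, which is `r`, and the potential is at most `n * r`.
unbalanced-regular : ∀ {n} (G : Graph n) r .{{_ : NonZero r}} p → n < 2 ^ suc p * r →
  ∀ {A B} → Disjoint A B → size B ≤ size A → ∃ (_∈ A) → (∀ a → a ∈ A → (p + 3) * r ≤ deg (adj G) B a) →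
  HasRegularSubgraph r G
unbalanced-regular {n} G r p n< {A} {B} disjoint size≤ (a , a∈A) degrees =
  -- With zero weights this merely trims `A` to the size of `B`.
  from-selection (dropLargest A (λ _ → 0) (size A ∸ size B) (m∸n≤m (size A) (size B)))
  where
  open ≤-Reasoning
  open +-*-Solver using (solve; _:=_; _:+_; _:*_; con)
  -- The summand 3 leaves d - 2r = (p + 1) r, where `φ` takes the value 2^(p + 1) r, which exceeds
  -- `n`.
  d = (p + 3) * r

  d∸2r : d ∸ (r + r) ≡ suc p * r
  d∸2r = trans (cong (_∸ (r + r)) (solve 2 (λ p r → (p :+ con 3) :* r := (con 1 :+ p) :* r :+ (r :+ r)) refl p r))
    (m+n∸n≡m (suc p * r) (r + r))

  d∸r : d ∸ r ≡ suc (suc p) * r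
  d∸r = trans (cong (_∸ r) (solve 2 (λ p r → (p :+ con 3) :* r := (con 2 :+ p) :* r :+ r) refl p r))
    (m+n∸n≡m (suc (suc p) * r) r)

  heavy : ∀ {q x} → suc p ≤ q → x ≡ q * r → n < φ r x
  heavy {q} p<q refl = ≤-trans n< (≤-trans (*-monoˡ-≤ r (^-monoʳ-≤ 2 p<q)) (≤-reflexive (sym (φ-multiple r q))))

  r≤size : r ≤ size B
  r≤size = begin
    r                    ≤⟨ m≤m+n r _ ⟩
    r + (p + 2) * r      ≡⟨ solve 2 (λ p r → r :+ (p :+ con 2) :* r := (p :+ con 3) :* r) refl p r ⟩
    d                    ≤⟨ degrees a a∈A ⟩
    deg (adj G) B a      ≤⟨ deg≤size (adj G) B a ⟩
    size B               ∎

  initial : ∀ {A'} → A' ⊆ A → potential G r d A' B ≤ n * r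
  initial {A'} A'⊆A = begin
    potential G r d A' B           ≡⟨ ∑∈-cong A' (λ u u∈A' → cong (φ r) (m≤n⇒m∸n≡0 (degrees u (A'⊆A u u∈A')))) ⟩
    ∑∈ A' (λ _ → φ r 0)            ≡⟨ ∑∈-const A' (φ r 0) ⟩
    φ r 0 * size A'                ≡⟨ cong (_* size A') (trans (φ-multiple r 0) (*-identityˡ r)) ⟩
    r * size A'                    ≤⟨ *-monoʳ-≤ r (size≤n A') ⟩
    r * n                          ≡⟨ *-comm r n ⟩
    n * r                          ∎

  from-selection : (∃ λ A' → ∃ λ θ → A' ⊆ A × size A' + (size A ∸ size B) ≡ size A × _) → HasRegularSubgraph r G
  from-selection (A' , _ , A'⊆A , size≡ , _) = descent G r d (<⇒≤ (heavy ≤-refl d∸2r)) (heavy (n≤1+n _) d∸r) r≤size record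
    { A          = A'
    ; B          = B
    ; disjoint   = λ u u∈A' → disjoint u (A'⊆A u u∈A')
    ; size-A     = +-cancelʳ-≡ (size A ∸ size B) _ _ (trans size≡ (sym (m+[n∸m]≡n size≤)))
    ; size-B     = refl
    ; potential≤ = initial A'⊆A
    }

-- The larger side of the cut plays the part of `A`; each of its vertices has at least half of its
-- neighbours on the other side, which absorbs the factor 2.
cut-regular : ∀ {n} (G : Graph n) r .{{_ : NonZero r}} p → n < 2 ^ suc p * r →
  ∀ {U P Q} → Split U P Q → size Q ≤ size P → ∃ (_∈ U) → (∀ v → v ∈ U → 2 * ((p + 3) * r) ≤ deg (adj G) U v) →
  (∀ v → v ∈ P → deg (adj G) P v ≤ deg (adj G) Q v) → HasRegularSubgraph r G
cut-regular G r p n< {U} {P} {Q} split Q≤P (u , u∈U) U-degrees P-degrees =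
  unbalanced-regular G r p n< (split-disjoint split) Q≤P nonempty degrees
  where
  open ≤-Reasoning

  nonempty : ∃ (_∈ P)
  nonempty = size-positive P (≰⇒> λ P≤0 → contradiction (term≤∑∈ U (λ _ → 1) u∈U) (<⇒≱ (begin-strict
    size U             ≡⟨ ∑∈-split split _ ⟩
    size P + size Q    ≤⟨ +-mono-≤ P≤0 (≤-trans Q≤P P≤0) ⟩
    0                  <⟨ z<s ⟩
    1                  ∎)))

  degrees : ∀ v → v ∈ P → (p + 3) * r ≤ deg (adj G) Q v
  degrees v v∈P = *-cancelˡ-≤ 2 (begin
    2 * ((p + 3) * r)                        ≤⟨ U-degrees v (split-⊆ split v v∈P) ⟩
    deg (adj G) U v                          ≡⟨ ∑∈-split split _ ⟩
    deg (adj G) P v + deg (adj G) Q v        ≤⟨ +-monoˡ-≤ _ (P-degrees v v∈P) ⟩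
    deg (adj G) Q v + deg (adj G) Q v        ≡⟨ cong (deg (adj G) Q v +_) (+-identityʳ _) ⟨
    2 * deg (adj G) Q v                      ∎)

-- The constant 16 is 4 · 4: p + 3 ≤ 4 p, one factor 2 is lost in passing from the average to the
-- minimum degree, and one in passing to a cut.
average-degree : ∀ {n} (G : Graph n) r .{{_ : NonZero r}} p → 1 ≤ p → 2 ^ p * r ≤ n → AvgDegreeCondition 16 r G →
  2 * (2 * ((p + 3) * r)) * size (full {n}) ≤ cross G full full
average-degree {n} G r p 1≤p low condition = begin
  2 * (2 * ((p + 3) * r)) * size (full {n})    ≡⟨ cong (2 * (2 * ((p + 3) * r)) *_) (size-full n) ⟩
  2 * (2 * ((p + 3) * r)) * n                  ≡⟨ solve 3 (λ p r n → con 2 :* (con 2 :* ((p :+ con 3) :* r)) :* n := (con 4 :* (p :+ con 3)) :* (r :* n)) refl p r n ⟩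
  4 * (p + 3) * (r * n)                        ≤⟨ *-monoˡ-≤ (r * n) (*-monoʳ-≤ 4 (+-monoʳ-≤ p (*-monoʳ-≤ 3 1≤p))) ⟩
  4 * (p + 3 * p) * (r * n)                    ≡⟨ solve 3 (λ p r n → con 4 :* (p :+ con 3 :* p) :* (r :* n) := p :* (con 16 :* r :* n)) refl p r n ⟩
  p * (16 * r * n)                             ≤⟨ degreeSum-large 16 r p G condition low ⟩
  degreeSum G                                  ≡⟨ degreeSum-deg G ⟩
  cross G full full                            ∎
  where
  open ≤-Reasoning
  open +-*-Solver using (solve; _:=_; _:+_; _:*_; con)

min-degree-regular : ∀ {n} (G : Graph n) r .{{_ : NonZero r}} p → n < 2 ^ suc p * r →
  ∀ U → ∃ (_∈ U) → (∀ v → v ∈ U → 2 * ((p + 3) * r) ≤ deg (adj G) U v) → HasRegularSubgraph r G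
min-degree-regular G r p n< U nonempty U-degrees
  -- The local search starts from the trivial cut of `U` and the empty set, with `cross U U` as a
  -- bound on the number of moves.
  with P , Q , split , P-degrees , Q-degrees ← local-max-cut G U (cross G U U) U (λ _ → false)
    (split-by λ _ → sym (+-identityʳ _)) (m≤n+m _ _)
  with ≤-total (size Q) (size P)
... | inj₁ Q≤P = cut-regular G r p n< split Q≤P nonempty U-degrees P-degrees
... | inj₂ P≤Q = cut-regular G r p n< (split-swap split) P≤Q nonempty U-degrees Q-degrees

dense-regular : ∀ {n} (G : Graph n) r .{{_ : NonZero r}} p → 2 * r ≤ n → n < 2 ^ suc p * r →
  2 * (2 * ((p + 3) * r)) * size (full {n}) ≤ cross G full full → HasRegularSubgraph r G
dense-regular {n} G r p 2r≤n high dense = from-subgraph (min-degree-subgraph G (2 * ((p + 3) * r)) n full (size≤n full) nonempty dense)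
  where
  nonempty : ∃ (_∈ full {n})
  nonempty = size-positive full (≤-trans (>-nonZero⁻¹ r) (≤-trans (m≤m+n r _)
    (≤-trans 2r≤n (≤-reflexive (sym (size-full n))))))

  from-subgraph : (∃ λ U → ∃ (_∈ U) × (∀ v → v ∈ U → 2 * ((p + 3) * r) ≤ deg (adj G) U v)) → HasRegularSubgraph r G
  from-subgraph (U , inhabited , U-degrees) = min-degree-regular G r p high U inhabited U-degrees

theorem1p5 : Σ ℕ λ C → (r n : ℕ) → 1 ≤ r → 2 * r ≤ n →
    (G : Graph n) → AvgDegreeCondition C r G → HasRegularSubgraph r G
theorem1p5 = 16 , λ r n 1≤r 2r≤n G condition → regular r {{>-nonZero 1≤r}} G 2r≤n condition
  where
  regular : ∀ r .{{_ : NonZero r}} {n} (G : Graph n) → 2 * r ≤ n → AvgDegreeCondition 16 r G → HasRegularSubgraph r G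
  regular r {n} G 2r≤n condition = from-power (powerOfTwoBelow r n 2r≤n)
    where
    from-power : (∃ λ p → 1 ≤ p × 2 ^ p * r ≤ n × n < 2 ^ suc p * r) → HasRegularSubgraph r G
    from-power (p , 1≤p , low , high) = dense-regular G r p 2r≤n high (average-degree G r p 1≤p low condition)
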